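{- Let $r\geq 3$, $k\geq 1$ and $\ell_1\geq\cdots\geq\ell_k\geq 2$ be integers, let $s\geq r$ be an integer, and let $n$ be sufficiently large. (i) If $s\leq k+r-2$, then $$\mathrm{ex}_r(n,K_s^{(r)},S^r_{\ell_1}\cup\cdots\cup S^r_{\ell_k})=\sum_{i=0}^{r-1}\binom{k-1}{s-i}\binom{n-k+1}{i}+\max_{\mathcal{G}\in\mathcal{F}_r(n-k+1,S^r_{\ell_k})}\sum_{i=r}^{s}\binom{k-1}{s-i}\mathcal{N}(K_i^{(r)},\mathcal{G}).$$ (ii) If $s\geq k+r-1$, then $\mathrm{ex}_r(n,K_s^{(r)},S^r_{\ell_1}\cup\cdots\cup S^r_{\ell_k})=O(n^{r-2})$. Moreover, if $k+r-1\leq s\leq\sum_{i=1}^k(\ell_i+1)+r-3$, then $\mathrm{ex}_r(n,K_s^{(r)},S^r_{\ell_1}\cup\cdots\cup S^r_{\ell_k})=\Theta(n^{r-2})$.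
   Context: An $r$-graph is a hypergraph all of whose hyperedges have exactly $r$ vertices. $K_i^{(r)}$ is the complete $r$-graph on $i$ vertices ($i\geq r$). $S_\ell$ is the star with $\ell$ edges. For a graph $F$, the $r$-expansion $F^r$ is obtained from $F$ by adding $r-2$ new vertices to each edge, all new vertices distinct from each other and from $V(F)$. $\cup$ denotes vertex-disjoint union. $\mathcal{N}(\mathcal{G}_1,\mathcal{G}_2)$ is the number of copies of $\mathcal{G}_1$ in $\mathcal{G}_2$. For an $r$-graph $\mathcal{H}$, $\mathcal{F}_r(m,\mathcal{H})$ is the family of all $m$-vertex $r$-graphs containing no copy of $\mathcal{H}$. $\mathrm{ex}_r(n,\mathcal{H},\mathcal{F})$ is the maximum number of copies of $\mathcal{H}$ in an $n$-vertex $r$-graph containing no copy of $\mathcal{F}$. Binomial coefficients: $\binom{a}{b}=0$ if $a<b$ (or $b<0$), and $\binom{0}{0}=1$. -}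

module Defs where

open import Level using (0ℓ)
open import Data.Nat using (ℕ; zero; suc; _+_; _*_; _∸_; _≤_; _≡ᵇ_)
open import Data.Bool using (Bool; true; false; T; _∧_; _∨_; not)
open import Data.Fin using (Fin; fromℕ)
open import Data.Fin.Subset using (Subset; ∣_∣; ⋃; ⁅_⁆)
open import Data.List using (List; []; _∷_; _++_; map; length; filterᵇ; allFin; upTo)
open import Data.Bool.ListAction using (all)
open import Data.Nat.ListAction using (sum)
open import Data.Vec using (Vec; []; _∷_)
open import Data.Product using (Σ; _×_; _,_)
open import Data.Sum using (_⊎_; inj₁; inj₂)
open import Data.Unit using (⊤; tt)
open import Relation.Nullary using (¬_)
open import Relation.Binary.PropositionalEquality using (_≡_)
open import Function.Definitions using (Injective)

record RGraph (r n : ℕ) : Set where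
  field
    edge    : Subset n → Bool
    uniform : ∀ e → T (edge e) → ∣ e ∣ ≡ r
open RGraph public

allSubsets : ∀ n → List (Subset n)
allSubsets zero    = [] ∷ []
allSubsets (suc n) = map (true ∷_) (allSubsets n) ++ map (false ∷_) (allSubsets n)

_⊆ᵇ_ : ∀ {n} → Subset n → Subset n → Bool
[]      ⊆ᵇ []      = true
(a ∷ t) ⊆ᵇ (b ∷ s) = (not a ∨ b) ∧ (t ⊆ᵇ s)

isCopyOfK : ∀ {r n} → RGraph r n → ℕ → Subset n → Bool
isCopyOfK {r} {n} G i S =
  (∣ S ∣ ≡ᵇ i) ∧ all (λ U → not ((∣ U ∣ ≡ᵇ r) ∧ (U ⊆ᵇ S)) ∨ edge G U) (allSubsets n)

-- N(K_i^(r), G): number of copies of K_i^(r) in G (for i ≥ r a copy of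
-- K_i^(r) is determined by its vertex set)
NK : ∀ {r n} → ℕ → RGraph r n → ℕ
NK {r} {n} i G = length (filterᵇ (isCopyOfK G i) (allSubsets n))

record PHyp : Set₁ where
  field
    V    : Set
    E    : Set
    edge : E → List V

Contains : ∀ {r n} → PHyp → RGraph r n → Set
Contains {r} {n} F G =
  Σ (PHyp.V F → Fin n) λ f →
    Injective _≡_ _≡_ f ×
    (∀ e → T (edge G (⋃ (map (λ v → ⁅ f v ⁆) (PHyp.edge F e)))))

record Graph : Set₁ where
  field
    V    : Set
    E    : Set
    ends : E → V × V

expansion : ℕ → Graph → PHyp
expansion r F = record
  { V    = Graph.V F ⊎ (Graph.E F × Fin (r ∸ 2))
  ; E    = Graph.E F
  ; edge = λ e → let (u , v) = Graph.ends F e in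
                 inj₁ u ∷ inj₁ v ∷ map (λ t → inj₂ (e , t)) (allFin (r ∸ 2))
  }

star : ℕ → Graph
star ℓ = record { V = ⊤ ⊎ Fin ℓ ; E = Fin ℓ ; ends = λ j → inj₁ tt , inj₂ j }

⋃disj : ∀ k → (Fin k → PHyp) → PHyp
⋃disj k F = record
  { V    = Σ (Fin k) (λ i → PHyp.V (F i))
  ; E    = Σ (Fin k) (λ i → PHyp.E (F i))
  ; edge = λ { (i , e) → map (λ v → (i , v)) (PHyp.edge (F i) e) }
  }

starForest : ℕ → ∀ k → (Fin k → ℕ) → PHyp
starForest r k ℓ = ⋃disj k (λ i → expansion r (star (ℓ i)))

-- last entry ℓ_k of (ℓ_1,...,ℓ_k)  (0 if k = 0, never used)
lastOf : ∀ {k} → (Fin k → ℕ) → ℕ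
lastOf {zero}  ℓ = 0
lastOf {suc k} ℓ = ℓ (fromℕ k)

IsMax : {A : Set} → (A → Set) → (A → ℕ) → ℕ → Set
IsMax {A} P f m = (Σ A λ a → P a × f a ≡ m) × (∀ a → P a → f a ≤ m)

IsEx : ℕ → ℕ → ℕ → PHyp → ℕ → Set
IsEx r n s F m = IsMax {RGraph r n} (λ G → ¬ Contains F G) (NK s) m

sumFromTo : ℕ → ℕ → (ℕ → ℕ) → ℕ
sumFromTo a b f = sum (map (λ j → f (a + j)) (upTo (suc b ∸ a)))

sumFin : ∀ k → (Fin k → ℕ) → ℕ
sumFin k f = sum (map f (allFin k))

{-# OPTIONS --safe #-}

-- A star expansion S^r_ℓ is a sunflower with ℓ petals and a one-point core.  Call a vertex big
-- if it is the core of a sunflower with L petals, L a large constant.  Given k big vertices, or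
-- k − 1 big vertices and a copy of S^r_{ℓ_k} avoiding them, the whole forest is found greedily.
-- A vertex v that is not the core of L petals has a bounded set N(v) meeting every edge through v
-- outside v (the union of a maximal sunflower).  If this holds for all vertices, every clique S
-- with at least r vertices lies in the third closure under N of some r − 2 vertices: at most
-- r − 2 vertices of S are missed by {v} ∪ N(v), and when exactly r − 2 are missed, one of them or
-- v itself is reachable from the others.  Hence there are only O(n^{r−2}) such cliques.
--
-- Splitting cliques along a set U of a vertices, N(K_s, G) ≤ Σ_i C(a, s−i) N(K_i, G − U), with
-- equality when all r-sets meeting U are edges, and N(K_i, G − U) = C(n−a, i) for i < r.  With
-- U ⊇ {big vertices} and a = k − 1, this gives the bound in (ii), since the terms with i < r vanish,
-- and, if exactly k − 1 vertices are big, the bound in (i).  With fewer big vertices take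
-- a = k − 2: the main term drops by C(k−2, s−r) C(n−k+1, r−1), which beats O(n^{r−2}).
-- The lower bound in (ii) comes from the r-sets with at least two points in a fixed set of
-- Σ(ℓ_i + 1) − 1 vertices, since each star uses ℓ_i + 1 of these vertices.

module Submission where

open import Defs
open import Data.Bool using (Bool; true; false; T; T?; _∧_; _∨_; not)
open import Data.Bool.Properties using (T-∧; T-∨; T-≡; ∧-identityʳ; ∧-zeroʳ)
open import Data.Bool.ListAction using (all)
open import Data.Empty using (⊥-elim)
open import Data.Fin using (Fin; zero; suc; inject≤; punchIn; fromℕ)
import Data.Fin as F
open import Data.Fin.Properties using (_≟_; any?; all?; inject≤-injective; punchIn-injective; punchInᵢ≢i; ≤fromℕ) renaming (suc-injective to Fin-suc-injective)
open import Data.Fin.Subset using (Subset; _∈_; _∉_; _⊆_; ∣_∣; ⋃; ⁅_⁆; _∩_)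
import Data.Fin.Subset as Subset
open import Data.Fin.Subset.Properties using (_∈?_; ∉⊥; x∈⁅x⁆; x∈⁅y⁆⇒x≡y; x∈p∪q⁺; x∈p∪q⁻; ⊆-antisym; anySubset?; ∣p∣≤n; p⊆q⇒∣p∣≤∣q∣; drop-∷-⊆; ∣⊥∣≡0; ∣⊤∣≡n; ∈⊤; x∈p∩q⁻)
open import Data.List using (List; []; _∷_; _++_; map; length; filter; filterᵇ; concatMap; allFin; lookup; tabulate; upTo; concat; take)
open import Data.List.Membership.Propositional using (find) renaming (_∈_ to _∈ˡ_; _∉_ to _∉ˡ_)
open import Data.List.Membership.Propositional.Properties
open import Data.List.Properties using (length-++; length-map; length-tabulate; map-∘; length-take; take++drop≡id; filter-notAll; map-++; upTo-∷ʳ; map-tabulate; tabulate-cong; map-cong)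
open import Data.List.Relation.Unary.All using (All; []; _∷_)
import Data.List.Relation.Unary.All as All
import Data.List.Relation.Unary.All.Properties as All
open import Data.List.Relation.Unary.AllPairs using ([]; _∷_)
import Data.List.Relation.Unary.AllPairs.Properties as AllPairs
open import Data.List.Relation.Unary.Any using (here; there; index)
import Data.List.Relation.Unary.Any as Any
open import Data.List.Relation.Unary.Any.Properties using (lookup-index)
open import Data.List.Relation.Unary.Unique.Propositional using (Unique)
import Data.List.Relation.Unary.Unique.Propositional.Properties as Unique
open import Data.Nat using (ℕ; zero; suc; _+_; _*_; _∸_; _^_; _≤_; _<_; z≤n; s≤s; s≤s⁻¹; _≡ᵇ_; _≤ᵇ_; _!; _≤?_; >-nonZero)
open import Data.Nat.Properties hiding (_≟_)
open import Data.Nat.Combinatorics using (_C_; nCk≡nC[n∸k]; nCn≡1; nC1≡n; nCk+nC[k+1]≡[n+1]C[k+1])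
open import Data.Nat.Combinatorics.Specification using (k>n⇒nCk≡0)
open import Data.Nat.ListAction using (sum)
open import Data.Nat.ListAction.Properties using (sum-++)
open import Data.Nat.Tactic.RingSolver using (solve-∀)
open import Data.Product using (Σ; ∃; _×_; _,_; proj₁; proj₂)
open import Data.Sum using (_⊎_; inj₁; inj₂; [_,_]′; map₁)
open import Data.Unit using (tt)
open import Data.Vec using (Vec; []; _∷_)
import Data.Vec as Vec
open import Data.Vec.Properties using (lookup∘tabulate; length-toList)
open Vec._[_]=_
open import Function using (_∘_; id; Equivalence)
open import Function.Definitions using (Injective)
open import Relation.Binary.PropositionalEquality using (_≡_; _≢_; refl; sym; trans; cong; cong₂; subst; subst₂; module ≡-Reasoning)
open import Relation.Nullary using (¬_; Dec; yes; no; contradiction)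
open import Relation.Nullary.Decidable using (map′; _×-dec_; ¬?; decidable-stable; _→-dec_)
open import Relation.Unary using (Decidable)

private
  variable
    A B : Set
    a b k n q r : ℕ

-- Lists and finite subsets

T-∧⁻ : ∀ {x y} → T (x ∧ y) → T x × T y
T-∧⁻ = Equivalence.to T-∧

T-∧⁺ : ∀ {x y} → T x → T y → T (x ∧ y)
T-∧⁺ p q = Equivalence.from T-∧ (p , q)

T-cong : ∀ {x y} → (T x → T y) → (T y → T x) → x ≡ y
T-cong {true}  {true}  _ _ = refl
T-cong {true}  {false} f _ = ⊥-elim (f tt)
T-cong {false} {true}  _ g = ⊥-elim (g tt)
T-cong {false} {false} _ _ = refl

-- Cut the head of `xs` out of `ys` at one occurrence. By uniqueness the other elements differ from
-- it, so they survive in the rest of `ys`.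
Unique-⊆⇒length≤ : {xs ys : List A} → Unique xs → (∀ {x} → x ∈ˡ xs → x ∈ˡ ys) → length xs ≤ length ys
Unique-⊆⇒length≤ {xs = []}     _          _   = z≤n
Unique-⊆⇒length≤ {xs = x ∷ xs} (x∉ ∷ uxs) sub with ∈-∃++ (sub (here refl))
... | ys , zs , refl = begin
  suc (length xs)               ≤⟨ s≤s (Unique-⊆⇒length≤ uxs sub′) ⟩
  suc (length (ys ++ zs))       ≡⟨ cong suc (length-++ ys) ⟩
  suc (length ys + length zs)   ≡⟨ sym (+-suc (length ys) (length zs)) ⟩
  length ys + suc (length zs)   ≡⟨ sym (length-++ ys) ⟩
  length (ys ++ x ∷ zs)         ∎
  where
  open ≤-Reasoning
  sub′ : ∀ {y} → y ∈ˡ xs → y ∈ˡ ys ++ zs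
  sub′ y∈ with ∈-++⁻ ys (sub (there y∈))
  ... | inj₁ y∈ys         = ∈-++⁺ˡ y∈ys
  ... | inj₂ (here refl)  = contradiction refl (All.lookup x∉ y∈)
  ... | inj₂ (there y∈zs) = ∈-++⁺ʳ ys y∈zs

lookup-injective : {xs : List A} → Unique xs → ∀ {i j} → lookup xs i ≡ lookup xs j → i ≡ j
lookup-injective (_  ∷ _) {zero}  {zero}  _  = refl
lookup-injective (x∉ ∷ _) {zero}  {suc j} eq = contradiction eq (All.lookup x∉ (∈-lookup j))
lookup-injective (x∉ ∷ _) {suc i} {zero}  eq = contradiction (sym eq) (All.lookup x∉ (∈-lookup i))
lookup-injective (_  ∷ u) {suc i} {suc j} eq = cong suc (lookup-injective u eq)

length-concatMap≤ : (f : A → List B) (c : ℕ) → (∀ x → length (f x) ≤ c) →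
                    ∀ xs → length (concatMap f xs) ≤ length xs * c
length-concatMap≤ f c f≤ []       = z≤n
length-concatMap≤ f c f≤ (x ∷ xs) = begin
  length (f x ++ concatMap f xs)          ≡⟨ length-++ (f x) ⟩
  length (f x) + length (concatMap f xs)  ≤⟨ +-mono-≤ (f≤ x) (length-concatMap≤ f c f≤ xs) ⟩
  c + length xs * c                       ∎
  where open ≤-Reasoning

∈-concatMap⁺′ : (f : A → List B) {x : A} {y : B} {xs : List A} → x ∈ˡ xs → y ∈ˡ f x → y ∈ˡ concatMap f xs
∈-concatMap⁺′ f x∈ y∈ = ∈-concatMap⁺ f (Any.map (λ { refl → y∈ }) x∈)

elements : Subset n → List (Fin n)
elements []            = []
elements (true  ∷ S) = zero ∷ map suc (elements S)
elements (false ∷ S) = map suc (elements S)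

length-elements : (S : Subset n) → length (elements S) ≡ ∣ S ∣
length-elements []          = refl
length-elements (true  ∷ S) = cong suc (trans (length-map suc (elements S)) (length-elements S))
length-elements (false ∷ S) = trans (length-map suc (elements S)) (length-elements S)

∈-elements⁺ : (S : Subset n) → ∀ {x} → x ∈ S → x ∈ˡ elements S
∈-elements⁺ (true  ∷ S) here      = here refl
∈-elements⁺ (true  ∷ S) (there p) = there (∈-map⁺ suc (∈-elements⁺ S p))
∈-elements⁺ (false ∷ S) (there p) = ∈-map⁺ suc (∈-elements⁺ S p)

∈-elements⁻ : (S : Subset n) → ∀ {x} → x ∈ˡ elements S → x ∈ S
∈-elements⁻ (true ∷ S) (here refl) = here
∈-elements⁻ (true ∷ S) (there p) with ∈-map⁻ suc p
... | _ , q , refl = there (∈-elements⁻ S q)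
∈-elements⁻ (false ∷ S) p with ∈-map⁻ suc p
... | _ , q , refl = there (∈-elements⁻ S q)

elements-unique : (S : Subset n) → Unique (elements S)
elements-unique []          = []
elements-unique (true  ∷ S) =
  All.map⁺ (All.tabulate (λ _ ())) ∷ Unique.map⁺ (λ { refl → refl }) (elements-unique S)
elements-unique (false ∷ S) = Unique.map⁺ (λ { refl → refl }) (elements-unique S)

fromList : List (Fin n) → Subset n
fromList xs = ⋃ (map ⁅_⁆ xs)

∈-fromList⁺ : ∀ {xs} {x : Fin n} → x ∈ˡ xs → x ∈ fromList xs
∈-fromList⁺ (here refl) = x∈p∪q⁺ (inj₁ (x∈⁅x⁆ _))
∈-fromList⁺ (there p)   = x∈p∪q⁺ (inj₂ (∈-fromList⁺ p))

∈-fromList⁻ : ∀ xs {x : Fin n} → x ∈ fromList xs → x ∈ˡ xs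
∈-fromList⁻ []       p = contradiction p ∉⊥
∈-fromList⁻ (y ∷ xs) p with x∈p∪q⁻ ⁅ y ⁆ (fromList xs) p
... | inj₁ q = here (x∈⁅y⁆⇒x≡y y q)
... | inj₂ q = there (∈-fromList⁻ xs q)

Unique⇒length≤∣∣ : {xs : List (Fin n)} → Unique xs → (S : Subset n) → (∀ {x} → x ∈ˡ xs → x ∈ S) → length xs ≤ ∣ S ∣
Unique⇒length≤∣∣ u S sub = subst (_ ≤_) (length-elements S) (Unique-⊆⇒length≤ u (∈-elements⁺ S ∘ sub))

∣∣≤length : (S : Subset n) (xs : List (Fin n)) → (∀ {x} → x ∈ S → x ∈ˡ xs) → ∣ S ∣ ≤ length xs
∣∣≤length S xs sub = subst (_≤ _) (length-elements S) (Unique-⊆⇒length≤ (elements-unique S) (sub ∘ ∈-elements⁻ S))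

∣fromList∣ : {xs : List (Fin n)} → Unique xs → ∣ fromList xs ∣ ≡ length xs
∣fromList∣ {xs = xs} u =
  ≤-antisym (∣∣≤length (fromList xs) xs (∈-fromList⁻ xs)) (Unique⇒length≤∣∣ u (fromList xs) ∈-fromList⁺)

outside-list : (S : Subset n) (xs : List (Fin n)) → length xs < ∣ S ∣ → ∃ λ x → x ∈ S × x ∉ˡ xs
outside-list S xs lt with any? (λ x → x ∈? S ×-dec ¬? (Any.any? (x ≟_) xs))
... | yes (x , x∈ , x∉) = x , x∈ , x∉
... | no ¬p = contradiction (∣∣≤length S xs λ {x} x∈ → decidable-stable (Any.any? (x ≟_) xs) (λ x∉ → ¬p (x , x∈ , x∉))) (<⇒≱ lt)

-- A bijection from `Fin m` onto the vertices with `P`. It supplies labels for vertex sets, as an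
-- embedding of a labelled pattern requires.
record Enumeration (P : Fin n → Set) (m : ℕ) : Set where
  field
    at       : Fin m → Fin n
    at-inj   : Injective _≡_ _≡_ at
    at-sat   : ∀ t → P (at t)
    at-surj  : ∀ {x} → P x → ∃ λ t → at t ≡ x
open Enumeration public

listEnumeration : {P : Fin n → Set} (xs : List (Fin n)) → Unique xs →
                  (∀ {x} → x ∈ˡ xs → P x) → (∀ {x} → P x → x ∈ˡ xs) → Enumeration P (length xs)
listEnumeration xs u sound complete = record
  { at      = lookup xs
  ; at-inj  = lookup-injective u
  ; at-sat  = λ t → sound (∈-lookup t)
  ; at-surj = λ p → index (complete p) , sym (lookup-index (complete p))
  }

enumerate : (S : Subset n) → Enumeration (_∈ S) ∣ S ∣
enumerate S = subst (Enumeration _) (length-elements S)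
  (listEnumeration (elements S) (elements-unique S) (∈-elements⁻ S) (∈-elements⁺ S))

enumerate-minus : ∀ {m} (S : Subset n) {c : Fin n} → c ∈ S → ∣ S ∣ ≡ suc m → Enumeration (λ x → x ∈ S × x ≢ c) m
enumerate-minus {m = m} S {c} c∈S eq = subst (Enumeration _) len (listEnumeration ys uys sound complete)
  where
  ≢c? : Decidable (_≢ c)
  ≢c? x = ¬? (x ≟ c)
  ys = filter ≢c? (elements S)
  uys : Unique ys
  uys = Unique.filter⁺ ≢c? (elements-unique S)
  sound : ∀ {x} → x ∈ˡ ys → x ∈ S × x ≢ c
  sound p with ∈-filter⁻ ≢c? {xs = elements S} p
  ... | q , x≢c = ∈-elements⁻ S q , x≢c
  complete : ∀ {x} → x ∈ S × x ≢ c → x ∈ˡ ys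
  complete (x∈S , x≢c) = ∈-filter⁺ ≢c? (∈-elements⁺ S x∈S) x≢c
  ucys : Unique (c ∷ ys)
  ucys = All.tabulate (λ p c≡x → proj₂ (sound p) (sym c≡x)) ∷ uys
  len : length ys ≡ m
  len = suc-injective (trans (≤-antisym
    (Unique⇒length≤∣∣ ucys S λ { (here refl) → c∈S ; (there p) → proj₁ (sound p) })
    (∣∣≤length S (c ∷ ys) cover)) eq)
    where
    cover : ∀ {x} → x ∈ S → x ∈ˡ c ∷ ys
    cover {x} x∈S with x ≟ c
    ... | yes refl = here refl
    ... | no x≢c   = there (complete (x∈S , x≢c))

pick : ∀ {t} (S : Subset n) → t ≤ ∣ S ∣ → Σ (Fin t → Fin n) λ c → Injective _≡_ _≡_ c × (∀ i → c i ∈ S)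
pick S t≤ = (λ i → at e (inject≤ i t≤)) , (λ eq → inject≤-injective t≤ t≤ _ _ (at-inj e eq)) , (λ i → at-sat e _)
  where e = enumerate S

subsetOf : {P : Fin n → Set} → Decidable P → Subset n
subsetOf P? = fromList (filter P? (allFin _))

∈-subsetOf⁺ : {P : Fin n → Set} (P? : Decidable P) → ∀ {x} → P x → x ∈ subsetOf P?
∈-subsetOf⁺ P? p = ∈-fromList⁺ (∈-filter⁺ P? (∈-allFin _) p)

∈-subsetOf⁻ : {P : Fin n → Set} (P? : Decidable P) → ∀ {x} → x ∈ subsetOf P? → P x
∈-subsetOf⁻ P? p = proj₂ (∈-filter⁻ P? {xs = allFin _} (∈-fromList⁻ (filter P? (allFin _)) p))

superset-of-size : ∀ t (S : Subset n) → ∣ S ∣ ≤ t → t ≤ n → ∃ λ U → ∣ U ∣ ≡ t × S ⊆ U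
superset-of-size zero [] _ _ = [] , refl , id
superset-of-size {n = suc n} t (true ∷ S) (s≤s le) (s≤s t≤n) with superset-of-size _ S le t≤n
... | U , eq , sub = true ∷ U , cong suc eq , λ { here → here ; (there p) → there (sub p) }
superset-of-size {n = suc n} t (false ∷ S) le t≤ with t ≤? n
... | yes t≤n with superset-of-size t S le t≤n
...   | U , eq , sub = false ∷ U , eq , λ { (there p) → there (sub p) }
-- Here `t = suc n`, so the whole vertex set is the only choice.
superset-of-size {n = suc n} t (false ∷ S) le t≤ | no t≰n =
  Subset.⊤ , trans (∣⊤∣≡n _) (≤-antisym (≰⇒> t≰n) t≤) , λ _ → ∈⊤

subset-of-size : ∀ t → t ≤ n → ∃ λ (U : Subset n) → ∣ U ∣ ≡ t
subset-of-size {n = n} t t≤n with superset-of-size t Subset.⊥ (subst (_≤ t) (sym (∣⊥∣≡0 n)) z≤n) t≤n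
... | U , eq , _ = U , eq

-- Binomial sums and sums over subsets

⟦_⟧ : Bool → ℕ
⟦ true  ⟧ = 1
⟦ false ⟧ = 0

⟦⟧-mono : ∀ {x y} → (T x → T y) → ⟦ x ⟧ ≤ ⟦ y ⟧
⟦⟧-mono {true}  {true}  _ = ≤-refl
⟦⟧-mono {true}  {false} f = ⊥-elim (f tt)
⟦⟧-mono {false} {_}     _ = z≤n

-- Unfolds at its exclusive upper end, which suits induction on the bound; `sumFromTo-Σ<` translates
-- the sums of the theorem into this form.
Σ< : ℕ → (ℕ → ℕ) → ℕ
Σ< zero    f = 0
Σ< (suc m) f = Σ< m f + f m

Σ<-cong : ∀ m {f g : ℕ → ℕ} → (∀ i → i < m → f i ≡ g i) → Σ< m f ≡ Σ< m g
Σ<-cong zero    eq = refl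
Σ<-cong (suc m) eq = cong₂ _+_ (Σ<-cong m (λ i i<m → eq i (m<n⇒m<1+n i<m))) (eq m ≤-refl)

Σ<-mono : ∀ m {f g : ℕ → ℕ} → (∀ i → i < m → f i ≤ g i) → Σ< m f ≤ Σ< m g
Σ<-mono zero    le = z≤n
Σ<-mono (suc m) le = +-mono-≤ (Σ<-mono m (λ i i<m → le i (m<n⇒m<1+n i<m))) (le m ≤-refl)

Σ<-zero : ∀ m {f : ℕ → ℕ} → (∀ i → i < m → f i ≡ 0) → Σ< m f ≡ 0
Σ<-zero zero    eq = refl
Σ<-zero (suc m) eq = cong₂ _+_ (Σ<-zero m (λ i i<m → eq i (m<n⇒m<1+n i<m))) (eq m ≤-refl)

+-interchange : ∀ w x y z → (w + x) + (y + z) ≡ (w + y) + (x + z)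
+-interchange = solve-∀

Σ<-+ : ∀ m (f g : ℕ → ℕ) → Σ< m (λ i → f i + g i) ≡ Σ< m f + Σ< m g
Σ<-+ zero    f g = refl
Σ<-+ (suc m) f g = trans (cong (_+ (f m + g m)) (Σ<-+ m f g)) (+-interchange (Σ< m f) (Σ< m g) (f m) (g m))

Σ<-*ʳ : ∀ m (f : ℕ → ℕ) c → Σ< m (λ i → f i * c) ≡ Σ< m f * c
Σ<-*ʳ zero    f c = refl
Σ<-*ʳ (suc m) f c = trans (cong (_+ f m * c) (Σ<-*ʳ m f c)) (sym (*-distribʳ-+ c (Σ< m f) (f m)))

Σ<-split : ∀ m l (f : ℕ → ℕ) → Σ< (m + l) f ≡ Σ< m f + Σ< l (λ j → f (m + j))
Σ<-split m zero    f rewrite +-identityʳ m = sym (+-identityʳ (Σ< m f))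
Σ<-split m (suc l) f rewrite +-suc m l | Σ<-split m l f = +-assoc (Σ< m f) _ _

sum-map-upTo : ∀ (f : ℕ → ℕ) m → sum (map f (upTo m)) ≡ Σ< m f
sum-map-upTo f zero    = refl
sum-map-upTo f (suc m) = begin
  sum (map f (upTo (suc m)))           ≡⟨ cong (sum ∘ map f) (sym (upTo-∷ʳ m)) ⟩
  sum (map f (upTo m ++ m ∷ []))       ≡⟨ cong sum (map-++ f (upTo m) (m ∷ [])) ⟩
  sum (map f (upTo m) ++ f m ∷ [])     ≡⟨ sum-++ (map f (upTo m)) (f m ∷ []) ⟩
  sum (map f (upTo m)) + (f m + 0)     ≡⟨ cong₂ _+_ (sum-map-upTo f m) (+-identityʳ (f m)) ⟩
  Σ< m f + f m                         ∎
  where open ≡-Reasoning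

sumFromTo-Σ< : ∀ x y f → sumFromTo x y f ≡ Σ< (suc y ∸ x) (λ j → f (x + j))
sumFromTo-Σ< x y f = sum-map-upTo (λ j → f (x + j)) (suc y ∸ x)

Σ<-sumFromTo : ∀ r s → r ≤ s → ∀ f → Σ< (suc s) f ≡ Σ< r f + sumFromTo r s f
Σ<-sumFromTo r s r≤s f = begin
  Σ< (suc s) f                                          ≡⟨ cong (λ m → Σ< m f) (sym (m+[n∸m]≡n (m≤n⇒m≤1+n r≤s))) ⟩
  Σ< (r + (suc s ∸ r)) f                                ≡⟨ Σ<-split r (suc s ∸ r) f ⟩
  Σ< r f + Σ< (suc s ∸ r) (λ j → f (r + j))             ≡⟨ cong (Σ< r f +_) (sym (sumFromTo-Σ< r s f)) ⟩
  Σ< r f + sumFromTo r s f                              ∎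
  where open ≡-Reasoning

nC0≡1 : ∀ m → m C 0 ≡ 1
nC0≡1 m = trans (nCk≡nC[n∸k] {k = 0} {n = m} z≤n) (nCn≡1 m)

C-pos : ∀ {m k} → k ≤ m → 1 ≤ m C k
C-pos {m} {zero} _ rewrite nC0≡1 m = ≤-refl
C-pos {suc m} {suc k} (s≤s k≤m) =
  ≤-trans (C-pos k≤m) (subst (m C k ≤_) (nCk+nC[k+1]≡[n+1]C[k+1] m k) (m≤m+n _ _))

-- If there are N i objects of size i, then (N ⊛ a) s counts the pairs of such an object and a
-- subset of Fin a with total size s.
_⊛_ : (ℕ → ℕ) → ℕ → ℕ → ℕ
(N ⊛ a) s = Σ< (suc s) (λ i → (a C (s ∸ i)) * N i)

⊛-zero : ∀ N s → (N ⊛ 0) s ≡ N s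
⊛-zero N s = cong₂ _+_ (Σ<-zero s below) top
  where
  below : ∀ i → i < s → (0 C (s ∸ i)) * N i ≡ 0
  below i i<s with s ∸ i | m<n⇒0<n∸m i<s
  ... | suc _ | _ = refl
  top : (0 C (s ∸ s)) * N s ≡ N s
  top rewrite n∸n≡0 s = +-identityʳ (N s)

⊛-suc-zero : ∀ N a → (N ⊛ suc a) 0 ≡ (N ⊛ a) 0
⊛-suc-zero N a = cong (_* N 0) (trans (nC0≡1 (suc a)) (sym (nC0≡1 a)))

-- Pascal's rule in every term: the additional point is used, leaving total size `s`, or it is not.
-- The last term `i = suc s` has coefficient 1 on both sides.
⊛-suc-suc : ∀ N a s → (N ⊛ suc a) (suc s) ≡ (N ⊛ a) s + (N ⊛ a) (suc s)
⊛-suc-suc N a s = begin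
  Σ< (suc s) (λ i → (suc a C (suc s ∸ i)) * N i) + (suc a C (s ∸ s)) * N (suc s)
    ≡⟨ cong₂ _+_ (trans (Σ<-cong (suc s) pascal) (Σ<-+ (suc s) _ _)) top ⟩
  ((N ⊛ a) s + Σ< (suc s) (λ i → (a C (suc s ∸ i)) * N i)) + (a C (s ∸ s)) * N (suc s)
    ≡⟨ +-assoc ((N ⊛ a) s) _ _ ⟩
  (N ⊛ a) s + (N ⊛ a) (suc s) ∎
  where
  open ≡-Reasoning
  pascal : ∀ i → i < suc s → (suc a C (suc s ∸ i)) * N i ≡ (a C (s ∸ i)) * N i + (a C (suc s ∸ i)) * N i
  pascal i (s≤s i≤s) rewrite +-∸-assoc 1 i≤s | sym (nCk+nC[k+1]≡[n+1]C[k+1] a (s ∸ i)) =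
    *-distribʳ-+ (N i) (a C (s ∸ i)) (a C suc (s ∸ i))
  top : (suc a C (s ∸ s)) * N (suc s) ≡ (a C (s ∸ s)) * N (suc s)
  top rewrite n∸n≡0 s = cong (_* N (suc s)) (trans (nC0≡1 (suc a)) (sym (nC0≡1 a)))

-- Recurses like `allSubsets`, so that a sum splits by whether the first vertex is in the set.
sumOver : ∀ n → (Subset n → ℕ) → ℕ
sumOver zero    f = f []
sumOver (suc n) f = sumOver n (f ∘ (true ∷_)) + sumOver n (f ∘ (false ∷_))

sumOver-cong : ∀ n {f g : Subset n → ℕ} → (∀ S → f S ≡ g S) → sumOver n f ≡ sumOver n g
sumOver-cong zero    eq = eq []
sumOver-cong (suc n) eq = cong₂ _+_ (sumOver-cong n (eq ∘ (true ∷_))) (sumOver-cong n (eq ∘ (false ∷_)))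

sumOver-mono : ∀ n {f g : Subset n → ℕ} → (∀ S → f S ≤ g S) → sumOver n f ≤ sumOver n g
sumOver-mono zero    le = le []
sumOver-mono (suc n) le = +-mono-≤ (sumOver-mono n (le ∘ (true ∷_))) (sumOver-mono n (le ∘ (false ∷_)))

sumOver-+ : ∀ n (f g : Subset n → ℕ) → sumOver n (λ S → f S + g S) ≡ sumOver n f + sumOver n g
sumOver-+ zero    f g = refl
sumOver-+ (suc n) f g
  rewrite sumOver-+ n (f ∘ (true ∷_)) (g ∘ (true ∷_)) | sumOver-+ n (f ∘ (false ∷_)) (g ∘ (false ∷_)) =
  +-interchange (sumOver n (f ∘ (true ∷_))) _ _ _

sumOver-zero : ∀ n → sumOver n (λ _ → 0) ≡ 0
sumOver-zero zero    = refl
sumOver-zero (suc n) = cong₂ _+_ (sumOver-zero n) (sumOver-zero n)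

term≤sumOver : ∀ n (f : Subset n → ℕ) S → f S ≤ sumOver n f
term≤sumOver zero    f []          = ≤-refl
term≤sumOver (suc n) f (true  ∷ S) = ≤-trans (term≤sumOver n (f ∘ (true ∷_)) S) (m≤m+n _ _)
term≤sumOver (suc n) f (false ∷ S) = ≤-trans (term≤sumOver n (f ∘ (false ∷_)) S) (m≤n+m _ _)

sumOver-size : ∀ n i → sumOver n (λ S → ⟦ ∣ S ∣ ≡ᵇ i ⟧) ≡ n C i
sumOver-size zero    zero    = refl
sumOver-size zero    (suc i) = refl
sumOver-size (suc n) zero    =
  trans (cong₂ _+_ (sumOver-zero n) (sumOver-size n 0)) (trans (nC0≡1 n) (sym (nC0≡1 (suc n))))
sumOver-size (suc n) (suc i) =
  trans (cong₂ _+_ (sumOver-size n i) (sumOver-size n (suc i))) (nCk+nC[k+1]≡[n+1]C[k+1] n i)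

length-filterᵇ-++ : ∀ {A : Set} (P : A → Bool) xs ys →
  length (filterᵇ P (xs ++ ys)) ≡ length (filterᵇ P xs) + length (filterᵇ P ys)
length-filterᵇ-++ P []       ys = refl
length-filterᵇ-++ P (x ∷ xs) ys with P x
... | true  = cong suc (length-filterᵇ-++ P xs ys)
... | false = length-filterᵇ-++ P xs ys

length-filterᵇ-map : ∀ {A B : Set} (P : B → Bool) (g : A → B) xs →
  length (filterᵇ P (map g xs)) ≡ length (filterᵇ (P ∘ g) xs)
length-filterᵇ-map P g []       = refl
length-filterᵇ-map P g (x ∷ xs) with P (g x)
... | true  = cong suc (length-filterᵇ-map P g xs)
... | false = length-filterᵇ-map P g xs

length-filterᵇ-allSubsets : ∀ n (P : Subset n → Bool) → length (filterᵇ P (allSubsets n)) ≡ sumOver n (⟦_⟧ ∘ P)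
length-filterᵇ-allSubsets zero P with P []
... | true  = refl
... | false = refl
length-filterᵇ-allSubsets (suc n) P = begin
  length (filterᵇ P (map (true ∷_) (allSubsets n) ++ map (false ∷_) (allSubsets n)))
    ≡⟨ length-filterᵇ-++ P (map (true ∷_) (allSubsets n)) (map (false ∷_) (allSubsets n)) ⟩
  length (filterᵇ P (map (true ∷_) (allSubsets n))) + length (filterᵇ P (map (false ∷_) (allSubsets n)))
    ≡⟨ cong₂ _+_ (part true) (part false) ⟩
  sumOver (suc n) (⟦_⟧ ∘ P) ∎
  where
  open ≡-Reasoning
  part : ∀ b → length (filterᵇ P (map (b ∷_) (allSubsets n))) ≡ sumOver n (⟦_⟧ ∘ P ∘ (b ∷_))
  part b = trans (length-filterᵇ-map P (b ∷_) (allSubsets n)) (length-filterᵇ-allSubsets n (P ∘ (b ∷_)))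

-- Shuffle a b n identifies Fin a ⊎ Fin b with Fin n monotonically on each side.
data Shuffle : ℕ → ℕ → ℕ → Set where
  done : Shuffle 0 0 0
  inˡ  : Shuffle a b n → Shuffle (suc a) b (suc n)
  inʳ  : Shuffle a b n → Shuffle a (suc b) (suc n)

merge : Shuffle a b n → Subset a → Subset b → Subset n
merge done     []      []      = []
merge (inˡ sh) (x ∷ A) X       = x ∷ merge sh A X
merge (inʳ sh) A       (x ∷ X) = x ∷ merge sh A X

left : Shuffle a b n → Subset n → Subset a
left done     []      = []
left (inˡ sh) (x ∷ S) = x ∷ left sh S
left (inʳ sh) (x ∷ S) = left sh S

right : Shuffle a b n → Subset n → Subset b
right done     []      = []
right (inˡ sh) (x ∷ S) = right sh S
right (inʳ sh) (x ∷ S) = x ∷ right sh S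

injʳ : Shuffle a b n → Fin b → Fin n
injʳ (inˡ sh) y       = suc (injʳ sh y)
injʳ (inʳ sh) zero    = zero
injʳ (inʳ sh) (suc y) = suc (injʳ sh y)

merge-left-right : ∀ (sh : Shuffle a b n) S → merge sh (left sh S) (right sh S) ≡ S
merge-left-right done     []      = refl
merge-left-right (inˡ sh) (x ∷ S) = cong (x ∷_) (merge-left-right sh S)
merge-left-right (inʳ sh) (x ∷ S) = cong (x ∷_) (merge-left-right sh S)

left-merge : ∀ (sh : Shuffle a b n) A X → left sh (merge sh A X) ≡ A
left-merge done     []      []      = refl
left-merge (inˡ sh) (x ∷ A) X       = cong (x ∷_) (left-merge sh A X)
left-merge (inʳ sh) A       (x ∷ X) = left-merge sh A X

right-merge : ∀ (sh : Shuffle a b n) A X → right sh (merge sh A X) ≡ X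
right-merge done     []      []      = refl
right-merge (inˡ sh) (x ∷ A) X       = right-merge sh A X
right-merge (inʳ sh) A       (x ∷ X) = cong (x ∷_) (right-merge sh A X)

∣merge∣ : ∀ (sh : Shuffle a b n) A X → ∣ merge sh A X ∣ ≡ ∣ A ∣ + ∣ X ∣
∣merge∣ done     []          []          = refl
∣merge∣ (inˡ sh) (true  ∷ A) X           = cong suc (∣merge∣ sh A X)
∣merge∣ (inˡ sh) (false ∷ A) X           = ∣merge∣ sh A X
∣merge∣ (inʳ sh) A           (true  ∷ X) = trans (cong suc (∣merge∣ sh A X)) (sym (+-suc ∣ A ∣ ∣ X ∣))
∣merge∣ (inʳ sh) A           (false ∷ X) = ∣merge∣ sh A X

∣left∣+∣right∣ : ∀ (sh : Shuffle a b n) S → ∣ left sh S ∣ + ∣ right sh S ∣ ≡ ∣ S ∣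
∣left∣+∣right∣ sh S = trans (sym (∣merge∣ sh (left sh S) (right sh S))) (cong ∣_∣ (merge-left-right sh S))

right-mono : ∀ (sh : Shuffle a b n) {S S′} → S ⊆ S′ → right sh S ⊆ right sh S′
right-mono (inʳ sh) {x ∷ S} {y ∷ S′} sub here with sub here
... | here = here
right-mono (inʳ sh) {x ∷ S} {y ∷ S′} sub (there p) = there (right-mono sh (drop-∷-⊆ sub) p)
right-mono (inˡ sh) {x ∷ S} {y ∷ S′} sub p         = right-mono sh (drop-∷-⊆ sub) p

merge-mono : ∀ (sh : Shuffle a b n) {A A′ X X′} → A ⊆ A′ → X ⊆ X′ → merge sh A X ⊆ merge sh A′ X′
merge-mono (inˡ sh) {x ∷ A} {y ∷ A′} A⊆ X⊆ here with A⊆ here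
... | here = here
merge-mono (inˡ sh) {x ∷ A} {y ∷ A′} A⊆ X⊆ (there p) = there (merge-mono sh (drop-∷-⊆ A⊆) X⊆ p)
merge-mono (inʳ sh) {X = x ∷ X} {y ∷ X′} A⊆ X⊆ here with X⊆ here
... | here = here
merge-mono (inʳ sh) {X = x ∷ X} {y ∷ X′} A⊆ X⊆ (there p) = there (merge-mono sh A⊆ (drop-∷-⊆ X⊆) p)

injʳ-∈⁺ : ∀ (sh : Shuffle a b n) S {y} → y ∈ right sh S → injʳ sh y ∈ S
injʳ-∈⁺ (inˡ sh) (x ∷ S) p         = there (injʳ-∈⁺ sh S p)
injʳ-∈⁺ (inʳ sh) (x ∷ S) here      = here
injʳ-∈⁺ (inʳ sh) (x ∷ S) (there p) = there (injʳ-∈⁺ sh S p)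

injʳ-∈⁻ : ∀ (sh : Shuffle a b n) S {y} → injʳ sh y ∈ S → y ∈ right sh S
injʳ-∈⁻ (inˡ sh) (x ∷ S) {y}     (there p) = injʳ-∈⁻ sh S p
injʳ-∈⁻ (inʳ sh) (x ∷ S) {zero}  here      = here
injʳ-∈⁻ (inʳ sh) (x ∷ S) {suc y} (there p) = there (injʳ-∈⁻ sh S p)

injʳ-injective : ∀ (sh : Shuffle a b n) {y y′} → injʳ sh y ≡ injʳ sh y′ → y ≡ y′
injʳ-injective (inˡ sh) eq = injʳ-injective sh (Fin-suc-injective eq)
injʳ-injective (inʳ sh) {zero}  {zero}  eq = refl
injʳ-injective (inʳ sh) {suc y} {suc z} eq = cong suc (injʳ-injective sh (Fin-suc-injective eq))

leftPart : Shuffle a b n → Subset n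
leftPart sh = merge sh Subset.⊤ Subset.⊥

injʳ-surjective : ∀ (sh : Shuffle a b n) {x} → x ∉ leftPart sh → ∃ λ y → injʳ sh y ≡ x
injʳ-surjective (inˡ sh) {zero}  x∉ = contradiction here x∉
injʳ-surjective (inˡ sh) {suc x} x∉ with injʳ-surjective sh (x∉ ∘ there)
... | y , refl = y , refl
injʳ-surjective (inʳ sh) {zero}  x∉ = zero , refl
injʳ-surjective (inʳ sh) {suc x} x∉ with injʳ-surjective sh (x∉ ∘ there)
... | y , refl = suc y , refl

injʳ∉leftPart : ∀ (sh : Shuffle a b n) y → injʳ sh y ∉ leftPart sh
injʳ∉leftPart sh y p = ∉⊥ (subst (y ∈_) (right-merge sh _ _) (injʳ-∈⁻ sh (leftPart sh) p))

∣leftPart∣ : (sh : Shuffle a b n) → ∣ leftPart sh ∣ ≡ a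
∣leftPart∣ {a} {b} sh = trans (∣merge∣ sh _ _) (trans (cong₂ _+_ (∣⊤∣≡n a) (∣⊥∣≡0 b)) (+-identityʳ a))

merge-⊥-disjoint : ∀ (sh : Shuffle a b n) X {x} → x ∈ merge sh Subset.⊥ X → x ∉ leftPart sh
merge-⊥-disjoint (inʳ sh) (y ∷ X) (there p) (there q) = merge-⊥-disjoint sh X p q
merge-⊥-disjoint (inˡ sh) X       (there p) (there q) = merge-⊥-disjoint sh X p q

shuffleAt : ∀ {a b} (U : Subset n) → ∣ U ∣ ≡ a → a + b ≡ n → Σ (Shuffle a b n) λ sh → leftPart sh ≡ U
shuffleAt {n = zero} {zero} {zero} [] _ _ = done , refl
shuffleAt {n = suc n} {suc a} {b} (true ∷ U) eq eq′ with shuffleAt U (suc-injective eq) (suc-injective eq′)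
... | sh , p = inˡ sh , cong (true ∷_) p
shuffleAt {n = suc n} {a} {zero} (false ∷ U) eq eq′ =
  contradiction (subst (_≤ n) (trans eq (trans (sym (+-identityʳ a)) eq′)) (∣p∣≤n U)) (<⇒≱ ≤-refl)
shuffleAt {n = suc n} {a} {suc b} (false ∷ U) eq eq′
  with shuffleAt U eq (suc-injective (trans (sym (+-suc a b)) eq′))
... | sh , p = inʳ sh , cong (false ∷_) p

initialShuffle : ∀ a b → Shuffle a b (a + b)
initialShuffle zero    zero    = done
initialShuffle zero    (suc b) = inʳ (initialShuffle zero b)
initialShuffle (suc a) b       = inˡ (initialShuffle a b)

sumOver-merge : ∀ (sh : Shuffle a b n) (f : Subset n → ℕ) →
  sumOver n f ≡ sumOver a (λ A → sumOver b (λ X → f (merge sh A X)))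
sumOver-merge done f = refl
sumOver-merge (inˡ sh) f = cong₂ _+_ (sumOver-merge sh _) (sumOver-merge sh _)
sumOver-merge {a} {suc b} (inʳ sh) f =
  trans (cong₂ _+_ (sumOver-merge sh (f ∘ (true ∷_))) (sumOver-merge sh (f ∘ (false ∷_))))
        (sym (sumOver-+ a (λ A → sumOver b (λ X → f (true ∷ merge sh A X))) (λ A → sumOver b (λ X → f (false ∷ merge sh A X)))))

-- Induction on `a`: a point in `A` lowers the remaining size by one, a point outside `A` keeps it,
-- and this is the recursion of `⊛`. For size 0 the sets with the point contribute nothing.
sumOver-⊛ : ∀ a b (w : Subset b → Bool) s →
  sumOver a (λ A → sumOver b (λ X → ⟦ (∣ A ∣ + ∣ X ∣ ≡ᵇ s) ∧ w X ⟧)) ≡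
  ((λ i → sumOver b (λ X → ⟦ (∣ X ∣ ≡ᵇ i) ∧ w X ⟧)) ⊛ a) s
sumOver-⊛ zero    b w s       = sym (⊛-zero _ s)
sumOver-⊛ (suc a) b w zero    =
  trans (cong₂ _+_ (trans (sumOver-cong a (λ _ → sumOver-zero b)) (sumOver-zero a)) (sumOver-⊛ a b w 0))
        (sym (⊛-suc-zero (λ i → sumOver b (λ X → ⟦ (∣ X ∣ ≡ᵇ i) ∧ w X ⟧)) a))
sumOver-⊛ (suc a) b w (suc s) =
  trans (cong₂ _+_ (sumOver-⊛ a b w s) (sumOver-⊛ a b w (suc s))) (sym (⊛-suc-suc _ a s))

-- Cliques

∈-allSubsets : (S : Subset n) → S ∈ˡ allSubsets n
∈-allSubsets []          = here refl
∈-allSubsets (true  ∷ S) = ∈-++⁺ˡ (∈-map⁺ (true ∷_) (∈-allSubsets S))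
∈-allSubsets (false ∷ S) = ∈-++⁺ʳ (map (true ∷_) (allSubsets _)) (∈-map⁺ (false ∷_) (∈-allSubsets S))

allSubsets-unique : ∀ n → Unique (allSubsets n)
allSubsets-unique zero    = [] ∷ []
allSubsets-unique (suc n) = Unique.++⁺ (part true) (part false) disjoint
  where
  part : ∀ x → Unique (map (x ∷_) (allSubsets n))
  part x = Unique.map⁺ (λ { refl → refl }) (allSubsets-unique n)
  disjoint : ∀ {S} → S ∈ˡ map (true ∷_) (allSubsets n) × S ∈ˡ map (false ∷_) (allSubsets n) → _
  disjoint (p , q) with ∈-map⁻ (true ∷_) p | ∈-map⁻ (false ∷_) q
  ... | _ , _ , refl | _ , _ , ()

⊆ᵇ⇒⊆ : (S S′ : Subset n) → T (S ⊆ᵇ S′) → S ⊆ S′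
⊆ᵇ⇒⊆ (true  ∷ S) (true ∷ S′) t here      = here
⊆ᵇ⇒⊆ (true  ∷ S) (true ∷ S′) t (there p) = there (⊆ᵇ⇒⊆ S S′ t p)
⊆ᵇ⇒⊆ (false ∷ S) (_    ∷ S′) t (there p) = there (⊆ᵇ⇒⊆ S S′ t p)

⊆⇒⊆ᵇ : (S S′ : Subset n) → S ⊆ S′ → T (S ⊆ᵇ S′)
⊆⇒⊆ᵇ []          []           sub = tt
⊆⇒⊆ᵇ (true  ∷ S) (y     ∷ S′) sub with sub here
... | here = ⊆⇒⊆ᵇ S S′ (drop-∷-⊆ sub)
⊆⇒⊆ᵇ (false ∷ S) (y     ∷ S′) sub = ⊆⇒⊆ᵇ S S′ (drop-∷-⊆ sub)

IsClique : RGraph r n → Subset n → Set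
IsClique {r} G S = ∀ {U} → ∣ U ∣ ≡ r → U ⊆ S → T (edge G U)

isClique? : RGraph r n → Subset n → Bool
isClique? {r} {n} G S = all (λ U → not ((∣ U ∣ ≡ᵇ r) ∧ (U ⊆ᵇ S)) ∨ edge G U) (allSubsets n)

isClique?⁻ : (G : RGraph r n) (S : Subset n) → T (isClique? G S) → IsClique G S
isClique?⁻ {r} {n} G S t {U} refl U⊆S = implied (All.lookup (All.all⁺ _ (allSubsets n) t) (∈-allSubsets U))
  where
  implied : ∀ {y} → T (not ((∣ U ∣ ≡ᵇ ∣ U ∣) ∧ (U ⊆ᵇ S)) ∨ y) → T y
  implied {y} with (∣ U ∣ ≡ᵇ ∣ U ∣) | ≡⇒≡ᵇ ∣ U ∣ ∣ U ∣ refl | (U ⊆ᵇ S) | ⊆⇒⊆ᵇ U S U⊆S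
  ... | true | _ | true | _ = id

isClique?⁺ : (G : RGraph r n) (S : Subset n) → IsClique G S → T (isClique? G S)
isClique?⁺ {r} {n} G S cl = All.all⁻ _ {xs = allSubsets n} (All.tabulate (λ {U} _ → implied U))
  where
  implied : ∀ U → T (not ((∣ U ∣ ≡ᵇ r) ∧ (U ⊆ᵇ S)) ∨ edge G U)
  implied U with ∣ U ∣ ≡ᵇ r in eq | (U ⊆ᵇ S) in eq′
  ... | false | _     = tt
  ... | true  | false = tt
  ... | true  | true  = cl (≡ᵇ⇒≡ ∣ U ∣ r (Equivalence.from T-≡ eq)) (⊆ᵇ⇒⊆ U S (Equivalence.from T-≡ eq′))

NK-sumOver : ∀ i (G : RGraph r n) → NK i G ≡ sumOver n (λ S → ⟦ (∣ S ∣ ≡ᵇ i) ∧ isClique? G S ⟧)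
NK-sumOver {n = n} i G = length-filterᵇ-allSubsets n (isCopyOfK G i)

-- Maxima are later sought among representatives of graphs with the same edges, so clique counts
-- have to agree for graphs that are equal edge by edge.
NK-ext : ∀ i (G H : RGraph r n) → (∀ S → edge G S ≡ edge H S) → NK i G ≡ NK i H
NK-ext {r} {n} i G H eq = begin
  NK i G                                                ≡⟨ NK-sumOver i G ⟩
  sumOver n (λ S → ⟦ (∣ S ∣ ≡ᵇ i) ∧ isClique? G S ⟧)    ≡⟨ sumOver-cong n (λ S → cong (λ x → ⟦ (∣ S ∣ ≡ᵇ i) ∧ x ⟧) (same S)) ⟩
  sumOver n (λ S → ⟦ (∣ S ∣ ≡ᵇ i) ∧ isClique? H S ⟧)    ≡⟨ sym (NK-sumOver i H) ⟩
  NK i H                                                ∎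
  where
  open ≡-Reasoning
  same : ∀ S → isClique? G S ≡ isClique? H S
  same S = T-cong
    (λ t → isClique?⁺ H S (λ {U} c sub → subst T (eq U) (isClique?⁻ G S t c sub)))
    (λ t → isClique?⁺ G S (λ {U} c sub → subst T (sym (eq U)) (isClique?⁻ H S t c sub)))

-- A set with fewer than `r` vertices has no `r`-subsets and is vacuously a clique. This produces
-- the binomials of the main term in (i).
NK-small : ∀ {i} → i < r → (G : RGraph r n) → NK i G ≡ n C i
NK-small {r} {n} {i} i<r G = trans (NK-sumOver i G) (trans (sumOver-cong n (cong ⟦_⟧ ∘ same)) (sumOver-size n i))
  where
  same : ∀ S → (∣ S ∣ ≡ᵇ i) ∧ isClique? G S ≡ (∣ S ∣ ≡ᵇ i)
  same S = T-cong (proj₁ ∘ T-∧⁻) λ t → T-∧⁺ t (isClique?⁺ G S λ { refl sub →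
    contradiction (p⊆q⇒∣p∣≤∣q∣ sub) (<⇒≱ (subst (_< r) (sym (≡ᵇ⇒≡ ∣ S ∣ i t)) i<r)) })

-- Counting cliques along a splitting of the vertex set

module _ (sh : Shuffle a b n) (G : RGraph r n) (H : RGraph r b) where

  private
    NK-merge : ∀ s → NK s G ≡ sumOver a (λ A → sumOver b (λ X → ⟦ isCopyOfK G s (merge sh A X) ⟧))
    NK-merge s = trans (length-filterᵇ-allSubsets n (isCopyOfK G s)) (sumOver-merge sh _)

    NK-split : ∀ s → sumOver a (λ A → sumOver b (λ X → ⟦ (∣ A ∣ + ∣ X ∣ ≡ᵇ s) ∧ isClique? H X ⟧)) ≡ ((λ i → NK i H) ⊛ a) s
    NK-split s = trans (sumOver-⊛ a b (isClique? H) s)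
      (Σ<-cong (suc s) (λ i _ → cong ((a C (s ∸ i)) *_) (sym (NK-sumOver i H))))

    size⁻ : ∀ s A X → T (∣ merge sh A X ∣ ≡ᵇ s) → T (∣ A ∣ + ∣ X ∣ ≡ᵇ s)
    size⁻ s A X = subst (λ m → T (m ≡ᵇ s)) (∣merge∣ sh A X)

  module _ (restricts : ∀ X → T (edge G (merge sh Subset.⊥ X)) → T (edge H X)) where

    merge-copy⁻ : ∀ s A X → T (isCopyOfK G s (merge sh A X)) → T ((∣ A ∣ + ∣ X ∣ ≡ᵇ s) ∧ isClique? H X)
    merge-copy⁻ s A X t = T-∧⁺ (size⁻ s A X (proj₁ (T-∧⁻ t))) (isClique?⁺ H X λ {U} c sub →
      restricts U (isClique?⁻ G _ (proj₂ (T-∧⁻ t)) (trans (∣merge∣ sh _ U) (trans (cong (_+ ∣ U ∣) (∣⊥∣≡0 a)) c))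
        (merge-mono sh (λ p → contradiction p ∉⊥) sub)))

    -- The right part of a clique of `G` is a clique of `H`; the left part is counted as if it were
    -- arbitrary.
    NK≤⊛ : ∀ s → NK s G ≤ ((λ i → NK i H) ⊛ a) s
    NK≤⊛ s = subst₂ _≤_ (sym (NK-merge s)) (NK-split s)
      (sumOver-mono a λ A → sumOver-mono b λ X → ⟦⟧-mono (merge-copy⁻ s A X))

    module _ (cone : ∀ U → ∣ U ∣ ≡ r → 1 ≤ ∣ left sh U ∣ ⊎ T (edge H (right sh U)) → T (edge G U)) where

      merge-copy⁺ : ∀ s A X → T ((∣ A ∣ + ∣ X ∣ ≡ᵇ s) ∧ isClique? H X) → T (isCopyOfK G s (merge sh A X))
      merge-copy⁺ s A X t = T-∧⁺ (subst (λ m → T (m ≡ᵇ s)) (sym (∣merge∣ sh A X)) (proj₁ (T-∧⁻ t)))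
        (isClique?⁺ G _ λ {U} c sub → cone U c (decide U c sub))
        where
        decide : ∀ U → ∣ U ∣ ≡ r → U ⊆ merge sh A X → 1 ≤ ∣ left sh U ∣ ⊎ T (edge H (right sh U))
        decide U c sub with ∣ left sh U ∣ in eq
        ... | suc _ = inj₁ (s≤s z≤n)
        ... | zero  = inj₂ (isClique?⁻ H X (proj₂ (T-∧⁻ {∣ A ∣ + ∣ X ∣ ≡ᵇ s} t))
          (trans (trans (cong (_+ ∣ right sh U ∣) (sym eq)) (∣left∣+∣right∣ sh U)) c)
          (λ p → subst (_ ∈_) (right-merge sh A X) (right-mono sh sub p)))

      -- When every `r`-set that meets the left side is an edge, any left part extends any clique of
      -- `H`, so the estimate `NK≤⊛` loses nothing.
      NK≡⊛ : ∀ s → NK s G ≡ ((λ i → NK i H) ⊛ a) s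
      NK≡⊛ s = trans (NK-merge s) (trans
        (sumOver-cong a λ A → sumOver-cong b λ X → cong ⟦_⟧ (T-cong (merge-copy⁻ s A X) (merge-copy⁺ s A X)))
        (NK-split s))

restrict : Shuffle a b n → RGraph r n → RGraph r b
restrict {a} sh G = record
  { edge    = λ X → edge G (merge sh Subset.⊥ X)
  ; uniform = λ X t → trans (cong (_+ ∣ X ∣) (sym (∣⊥∣≡0 a))) (trans (sym (∣merge∣ sh _ X)) (uniform G _ t))
  }

-- The extremal graph of (i), where `a = k - 1` and `H` is an optimal graph without the smallest
-- star.
coneOver : Shuffle a b n → RGraph r b → RGraph r n
coneOver {r = r} sh H = record
  { edge    = λ U → (∣ U ∣ ≡ᵇ r) ∧ ((1 ≤ᵇ ∣ left sh U ∣) ∨ edge H (right sh U))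
  ; uniform = λ U t → ≡ᵇ⇒≡ ∣ U ∣ r (proj₁ (T-∧⁻ t))
  }

coneOver-restricts : (sh : Shuffle a b n) (H : RGraph r b) → ∀ X → T (edge (coneOver sh H) (merge sh Subset.⊥ X)) → T (edge H X)
coneOver-restricts {a} {r = r} sh H X t = drop (left-merge sh Subset.⊥ X) (right-merge sh Subset.⊥ X)
  (proj₂ (T-∧⁻ {∣ merge sh Subset.⊥ X ∣ ≡ᵇ r} t))
  where
  drop : ∀ {A Y} → A ≡ Subset.⊥ {a} → Y ≡ X → T ((1 ≤ᵇ ∣ A ∣) ∨ edge H Y) → T (edge H X)
  drop refl refl t′ rewrite ∣⊥∣≡0 a = t′

coneOver-cone : (sh : Shuffle a b n) (H : RGraph r b) → ∀ U → ∣ U ∣ ≡ r → 1 ≤ ∣ left sh U ∣ ⊎ T (edge H (right sh U)) → T (edge (coneOver sh H) U)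
coneOver-cone {r = r} sh H U c p = T-∧⁺ (≡⇒≡ᵇ ∣ U ∣ r c) (Equivalence.from T-∨ (map₁ ≤⇒≤ᵇ p))

-- Sunflowers and star forests

-- A copy of `expansion r (star ℓ)` given by its edges, without labels on their vertices. If edges
-- have at least two vertices, `meet` also forces the petals to be distinct.
record Sunflower (G : RGraph r n) (c : Fin n) (ℓ : ℕ) : Set where
  field
    petal      : Fin ℓ → Subset n
    petal-edge : ∀ j → T (edge G (petal j))
    core       : ∀ j → c ∈ petal j
    meet       : ∀ {i j x} → x ∈ petal i → x ∈ petal j → x ≢ c → i ≡ j
open Sunflower public

subflower : {G : RGraph r n} {c : Fin n} {ℓ ℓ′ : ℕ} (σ : Fin ℓ′ → Fin ℓ) → Injective _≡_ _≡_ σ →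
            Sunflower G c ℓ → Sunflower G c ℓ′
subflower σ inj F = record
  { petal      = petal F ∘ σ
  ; petal-edge = petal-edge F ∘ σ
  ; core       = core F ∘ σ
  ; meet       = λ p q x≢c → inj (meet F p q x≢c)
  }

shrink : {G : RGraph r n} {c : Fin n} {ℓ ℓ′ : ℕ} → ℓ′ ≤ ℓ → Sunflower G c ℓ → Sunflower G c ℓ′
shrink le = subflower (λ j → inject≤ j le) (inject≤-injective le le _ _)

record Forest (G : RGraph r n) (k : ℕ) (ℓ : Fin k → ℕ) : Set where
  field
    centre   : Fin k → Fin n
    starAt   : ∀ i → Sunflower G (centre i) (ℓ i)
    disjoint : ∀ {i i′ j j′ x} → x ∈ petal (starAt i) j → x ∈ petal (starAt i′) j′ → i ≡ i′
open Forest public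

⋃-singletons : ∀ {V : Set} (f : V → Fin n) vs → ⋃ (map (λ v → ⁅ f v ⁆) vs) ≡ fromList (map f vs)
⋃-singletons f vs = cong ⋃ (map-∘ vs)

⋃-singletons-map : ∀ {V W : Set} (f : W → Fin n) (g : V → W) vs →
  ⋃ (map (λ v → ⁅ f (g v) ⁆) vs) ≡ ⋃ (map (λ w → ⁅ f w ⁆) (map g vs))
⋃-singletons-map f g vs = cong ⋃ (map-∘ vs)

∈-⋃-singletons⁺ : ∀ {V : Set} (f : V → Fin n) {v vs} → v ∈ˡ vs → f v ∈ ⋃ (map (λ v → ⁅ f v ⁆) vs)
∈-⋃-singletons⁺ f {vs = vs} p = subst (_ ∈_) (sym (⋃-singletons f vs)) (∈-fromList⁺ (∈-map⁺ f p))

∈-⋃-singletons⁻ : ∀ {V : Set} (f : V → Fin n) vs {x} → x ∈ ⋃ (map (λ v → ⁅ f v ⁆) vs) → ∃ λ v → v ∈ˡ vs × x ≡ f v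
∈-⋃-singletons⁻ f vs p = ∈-map⁻ f (∈-fromList⁻ (map f vs) (subst (_ ∈_) (⋃-singletons f vs) p))

StarVertex : ℕ → ℕ → Set
StarVertex r ℓ = PHyp.V (expansion r (star ℓ))

starEdge : ∀ r ℓ → Fin ℓ → List (StarVertex r ℓ)
starEdge r ℓ = PHyp.edge (expansion r (star ℓ))

StarEmbedding : RGraph r n → ℕ → Set
StarEmbedding {r} G ℓ = Contains (expansion r (star ℓ)) G

module _ {r ℓ : ℕ} {G : RGraph r n} where

  private
    edgeList : Fin ℓ → List (StarVertex r ℓ)
    edgeList = starEdge r ℓ

    ∈-edgeList : ∀ i j {v} → v ∈ˡ edgeList i → v ∈ˡ edgeList j → v ≢ inj₁ (inj₁ tt) → i ≡ j
    ∈-edgeList i j (here refl) _ v≢ = contradiction refl v≢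
    ∈-edgeList i j (there (here refl)) (there (here refl)) _ = refl
    ∈-edgeList i j (there (here refl)) (there (there q)) _ with ∈-map⁻ _ q
    ... | _ , _ , ()
    ∈-edgeList i j (there (there p)) q v≢ with ∈-map⁻ _ p
    ∈-edgeList i j (there (there p)) (there (there q)) v≢ | _ , _ , refl with ∈-map⁻ _ q
    ... | _ , _ , refl = refl

  embedding⇒sunflower : (E : StarEmbedding G ℓ) → Sunflower G (proj₁ E (inj₁ (inj₁ tt))) ℓ
  embedding⇒sunflower (f , f-inj , f-edge) = record
    { petal      = λ j → ⋃ (map (λ v → ⁅ f v ⁆) (edgeList j))
    ; petal-edge = f-edge
    ; core       = λ j → ∈-⋃-singletons⁺ f {vs = edgeList j} (here refl)
    ; meet       = λ {i} {j} → meets i j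
    }
    where
    meets : ∀ i j {x} → x ∈ ⋃ (map (λ v → ⁅ f v ⁆) (edgeList i)) → x ∈ ⋃ (map (λ v → ⁅ f v ⁆) (edgeList j)) →
            x ≢ f (inj₁ (inj₁ tt)) → i ≡ j
    meets i j p q x≢c with ∈-⋃-singletons⁻ f (edgeList i) p | ∈-⋃-singletons⁻ f (edgeList j) q
    ... | v , v∈ , refl | w , w∈ , fv≡fw with f-inj fv≡fw
    ...   | refl = ∈-edgeList i j v∈ w∈ λ { refl → x≢c refl }

-- A petal has `suc q` vertices besides the core: the first becomes the leaf of the star, the other
-- `q` become the vertices added by the expansion. The index in `Fin ℓ` supplies a petal through the
-- core for the second component.
embeds : {G : RGraph (suc (suc q)) n} {c : Fin n} {ℓ : ℕ} → Fin ℓ → (F : Sunflower G c ℓ) →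
         Σ (StarEmbedding G ℓ) λ E → ∀ v → ∃ λ j → proj₁ E v ∈ petal F j
embeds {q} {n} {G} {c} {ℓ} j₀ F = (f , f-inj , λ j → subst (T ∘ edge G) (sym (image j)) (petal-edge F j)) , f∈
  where
  V = StarVertex (suc (suc q)) ℓ
  enum : ∀ j → Enumeration (λ x → x ∈ petal F j × x ≢ c) (suc q)
  enum j = enumerate-minus (petal F j) (core F j) (uniform G (petal F j) (petal-edge F j))
  p : ∀ j t → Fin n
  p j t = at (enum j) t
  p-inj : ∀ {j t j′ t′} → p j t ≡ p j′ t′ → (j , t) ≡ (j′ , t′)
  p-inj {j} {t} {j′} {t′} eq with at-sat (enum j) t
  ... | x∈ , x≢ with meet F {j} {j′} x∈ (subst (_∈ petal F j′) (sym eq) (proj₁ (at-sat (enum j′) t′))) x≢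
  ...   | refl = cong (j ,_) (at-inj (enum j) eq)
  p≢c : ∀ {j t} → p j t ≢ c
  p≢c {j} {t} = proj₂ (at-sat (enum j) t)
  f : V → Fin n
  f (inj₁ (inj₁ tt)) = c
  f (inj₁ (inj₂ j))  = p j zero
  f (inj₂ (j , t))   = p j (suc t)
  f∈ : ∀ v → ∃ λ j → f v ∈ petal F j
  f∈ (inj₁ (inj₁ tt)) = j₀ , core F j₀
  f∈ (inj₁ (inj₂ j))  = j , proj₁ (at-sat (enum j) zero)
  f∈ (inj₂ (j , t))   = j , proj₁ (at-sat (enum j) (suc t))
  f-inj : Injective _≡_ _≡_ f
  f-inj {inj₁ (inj₁ tt)} {inj₁ (inj₁ tt)} eq = refl
  f-inj {inj₁ (inj₁ tt)} {inj₁ (inj₂ j)}  eq = contradiction (sym eq) p≢c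
  f-inj {inj₁ (inj₁ tt)} {inj₂ (j , t)}   eq = contradiction (sym eq) p≢c
  f-inj {inj₁ (inj₂ i)}  {inj₁ (inj₁ tt)} eq = contradiction eq p≢c
  f-inj {inj₁ (inj₂ i)}  {inj₁ (inj₂ j)}  eq with p-inj {i} {zero} {j} {zero} eq
  ... | refl = refl
  f-inj {inj₁ (inj₂ i)}  {inj₂ (j , t)}   eq with p-inj {i} {zero} {j} {suc t} eq
  ... | ()
  f-inj {inj₂ (i , t)}   {inj₁ (inj₁ tt)} eq = contradiction eq p≢c
  f-inj {inj₂ (i , t)}   {inj₁ (inj₂ j)}  eq with p-inj {i} {suc t} {j} {zero} eq
  ... | ()
  f-inj {inj₂ (i , t)}   {inj₂ (j , u)}   eq with p-inj {i} {suc t} {j} {suc u} eq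
  ... | refl = refl
  edgeList : Fin ℓ → List V
  edgeList j = inj₁ (inj₁ tt) ∷ inj₁ (inj₂ j) ∷ map (λ t → inj₂ (j , t)) (allFin q)
  image : ∀ j → ⋃ (map (λ v → ⁅ f v ⁆) (edgeList j)) ≡ petal F j
  image j = ⊆-antisym into onto
    where
    into : ⋃ (map (λ v → ⁅ f v ⁆) (edgeList j)) ⊆ petal F j
    into x∈ with ∈-⋃-singletons⁻ f (edgeList j) x∈
    ... | _ , here refl , refl         = core F j
    ... | _ , there (here refl) , refl = proj₁ (at-sat (enum j) zero)
    ... | _ , there (there v∈) , refl with ∈-map⁻ (λ t → inj₂ (j , t)) v∈
    ...   | t , _ , refl = proj₁ (at-sat (enum j) (suc t))
    onto : petal F j ⊆ ⋃ (map (λ v → ⁅ f v ⁆) (edgeList j))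
    onto {x} x∈ with x ≟ c
    ... | yes refl = ∈-⋃-singletons⁺ f {vs = edgeList j} (here refl)
    ... | no x≢c with at-surj (enum j) (x∈ , x≢c)
    ...   | zero  , refl = ∈-⋃-singletons⁺ f {vs = edgeList j} (there (here refl))
    ...   | suc t , refl = ∈-⋃-singletons⁺ f {vs = edgeList j} (there (there (∈-map⁺ _ (∈-allFin t))))

forest⇒contains : {G : RGraph (suc (suc q)) n} {ℓ : Fin k → ℕ} → (∀ i → Fin (ℓ i)) →
                  Forest G k ℓ → Contains (starForest (suc (suc q)) k ℓ) G
forest⇒contains {q} {n} {k} {G} {ℓ} j₀ 𝓕 = f , f-inj , f-edge
  where
  E : ∀ i → StarEmbedding G (ℓ i)
  E i = proj₁ (embeds (j₀ i) (starAt 𝓕 i))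
  f : Σ (Fin k) (λ i → StarVertex (suc (suc q)) (ℓ i)) → Fin n
  f (i , v) = proj₁ (E i) v
  f-inj : Injective _≡_ _≡_ f
  f-inj {i , v} {i′ , v′} eq with proj₂ (embeds (j₀ i) (starAt 𝓕 i)) v | proj₂ (embeds (j₀ i′) (starAt 𝓕 i′)) v′
  ... | j , p | j′ , p′ with disjoint 𝓕 p (subst (_∈ petal (starAt 𝓕 i′) j′) (sym eq) p′)
  ...   | refl = cong (i ,_) (proj₁ (proj₂ (E i)) eq)
  f-edge : ∀ e → T (edge G (⋃ (map (λ v → ⁅ f v ⁆) (PHyp.edge (starForest (suc (suc q)) k ℓ) e))))
  f-edge (i , e) = subst (T ∘ edge G) (⋃-singletons-map f (i ,_) (starEdge (suc (suc q)) (ℓ i) e)) (proj₂ (proj₂ (E i)) e)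

contains⇒forest : {G : RGraph r n} {ℓ : Fin k → ℕ} → Contains (starForest r k ℓ) G → Forest G k ℓ
contains⇒forest {r} {n} {k} {G} {ℓ} (f , f-inj , f-edge) = record
  { centre   = λ i → f (i , inj₁ (inj₁ tt))
  ; starAt   = λ i → embedding⇒sunflower {G = G} (E i)
  ; disjoint = λ {i} {i′} {j} {j′} → disj i i′ j j′
  }
  where
  E : ∀ i → StarEmbedding G (ℓ i)
  E i = (λ v → f (i , v)) , (λ eq → drop-pair (f-inj eq)) , 
    λ e → subst (T ∘ edge G) (sym (⋃-singletons-map f (i ,_) (starEdge r (ℓ i) e))) (f-edge (i , e))
    where
    drop-pair : ∀ {v w} → (i , v) ≡ (i , w) → v ≡ w
    drop-pair refl = refl
  disj : ∀ i i′ j j′ {x} → x ∈ petal (embedding⇒sunflower {G = G} (E i)) j → x ∈ petal (embedding⇒sunflower {G = G} (E i′)) j′ → i ≡ i′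
  disj i i′ j j′ p p′ with ∈-⋃-singletons⁻ (λ v → f (i , v)) (starEdge r (ℓ i) j) p | ∈-⋃-singletons⁻ (λ v → f (i′ , v)) (starEdge r (ℓ i′) j′) p′
  ... | v , _ , refl | w , _ , eq with f-inj eq
  ...   | refl = refl

-- At most one petal passes through a given vertex other than the core.
drop-petal : ∀ {m} {G : RGraph r n} {c : Fin n} (F : Sunflower G c (suc m)) {x : Fin n} → x ≢ c →
             Σ (Fin m → Fin (suc m)) λ σ → Injective _≡_ _≡_ σ × ∀ j → x ∉ petal F (σ j)
drop-petal F {x} x≢c with any? (λ i → x ∈? petal F i)
... | yes (i , x∈) = punchIn i , punchIn-injective i _ _ , λ j x∈′ → punchInᵢ≢i i j (sym (meet F x∈ x∈′ x≢c))
... | no ¬p        = suc , (λ { refl → refl }) , λ j x∈ → ¬p (suc j , x∈)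

-- Each vertex of `X` costs at most one petal, by `drop-petal`; hence the `length X` spare petals.
avoiding-petals : {G : RGraph r n} {c : Fin n} (ℓ : ℕ) (X : List (Fin n)) → c ∉ˡ X → (F : Sunflower G c (length X + ℓ)) →
                  Σ (Fin ℓ → Fin (length X + ℓ)) λ σ → Injective _≡_ _≡_ σ × ∀ j {x} → x ∈ˡ X → x ∉ petal F (σ j)
avoiding-petals ℓ []      c∉ F = id , id , λ _ ()
avoiding-petals ℓ (y ∷ X) c∉ F with drop-petal F {y} (λ { refl → c∉ (here refl) })
... | σ , σ-inj , y∉ with avoiding-petals ℓ X (c∉ ∘ there) (subflower σ σ-inj F)
...   | τ , τ-inj , X∉ = σ ∘ τ , τ-inj ∘ σ-inj , λ { j (here refl) → y∉ (τ j) ; j (there x∈) → X∉ j x∈ }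

avoiding : {G : RGraph r n} {c : Fin n} {L : ℕ} (ℓ : ℕ) (X : List (Fin n)) → length X + ℓ ≤ L → c ∉ˡ X → Sunflower G c L →
           Σ (Sunflower G c ℓ) λ F → ∀ j {x} → x ∈ˡ X → x ∉ petal F j
avoiding ℓ X le c∉ F with avoiding-petals ℓ X c∉ (shrink le F)
... | σ , σ-inj , X∉ = subflower σ σ-inj (shrink le F) , X∉

vertices : {G : RGraph r n} {c : Fin n} {ℓ : ℕ} → Sunflower G c ℓ → List (Fin n)
vertices {ℓ = ℓ} F = concatMap (elements ∘ petal F) (allFin ℓ)

∈-vertices⁺ : {G : RGraph r n} {c : Fin n} {ℓ : ℕ} (F : Sunflower G c ℓ) → ∀ j {x} → x ∈ petal F j → x ∈ˡ vertices F
∈-vertices⁺ F j x∈ = ∈-concatMap⁺′ (elements ∘ petal F) (∈-allFin j) (∈-elements⁺ (petal F j) x∈)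

∈-vertices⁻ : {G : RGraph r n} {c : Fin n} {ℓ : ℕ} (F : Sunflower G c ℓ) → ∀ {x} → x ∈ˡ vertices F → ∃ λ j → x ∈ petal F j
∈-vertices⁻ F x∈ with Any.satisfied (∈-concatMap⁻ (elements ∘ petal F) {xs = allFin _} x∈)
... | j , p = j , ∈-elements⁻ (petal F j) p

length-vertices : {G : RGraph r n} {c : Fin n} {ℓ : ℕ} (F : Sunflower G c ℓ) → length (vertices F) ≤ ℓ * r
length-vertices {r} {G = G} {ℓ = ℓ} F = subst (λ m → length (vertices F) ≤ m * r) (length-tabulate {n = ℓ} id)
  (length-concatMap≤ (elements ∘ petal F) r
    (λ j → ≤-reflexive (trans (length-elements (petal F j)) (uniform G _ (petal-edge F j)))) (allFin ℓ))

-- The last star is prescribed; the others are chosen greedily, one centre at a time,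
-- avoiding the vertices X used so far, the last star and the centres still to come.
greedy-forest : {G : RGraph r n} (L M : ℕ) (ℓ : Fin (suc a) → ℕ) → (∀ i → ℓ i ≤ M) →
  (c : Fin a → Fin n) → Injective _≡_ _≡_ c → (∀ i → Sunflower G (c i) L) →
  {z : Fin n} (Z : Sunflower G z (ℓ (fromℕ a))) → (∀ i j → c i ∉ petal Z j) →
  (X : List (Fin n)) → (∀ i → c i ∉ˡ X) → (∀ j {x} → x ∈ˡ X → x ∉ petal Z j) →
  length X + (a * suc (M * r) + (M * r + M)) ≤ L →
  Σ (Forest G (suc a) ℓ) λ 𝓕 → ∀ i j {x} → x ∈ˡ X → x ∉ petal (starAt 𝓕 i) j
greedy-forest {a = zero} L M ℓ _ c _ _ {z} Z _ X _ X∉Z _ =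
  record { centre = λ { zero → z } ; starAt = λ { zero → Z } ; disjoint = λ { {zero} {zero} _ _ → refl } } , λ { zero → X∉Z }
greedy-forest {r} {n} {suc a} {G} L M ℓ ℓ≤M c c-inj big {z} Z c∉Z X c∉X X∉Z bound = forest , avoids
  where
  later = tabulate (c ∘ suc)
  forbidden = X ++ (later ++ vertices Z)
  c₀∉ : c zero ∉ˡ forbidden
  c₀∉ p with ∈-++⁻ X p
  ... | inj₁ q = c∉X zero q
  ... | inj₂ q with ∈-++⁻ later q
  ...   | inj₁ q′ with ∈-tabulate⁻ q′
  ...     | i , eq with c-inj eq
  ...       | ()
  c₀∉ p | inj₂ q | inj₂ q′ with ∈-vertices⁻ Z q′
  ...   | j , q″ = c∉Z zero j q″
  -- The bound on `L` reserves `suc (M * r)` for each star still to be chosen, `M * r` for its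
  -- vertices and 1 for its centre, then `M * r` for the vertices of `Z` and `M` for the petals
  -- wanted now.
  small : length forbidden + ℓ zero ≤ L
  small = begin
    length forbidden + ℓ zero
      ≡⟨ cong (_+ ℓ zero) (trans (length-++ X) (cong (length X +_) (trans (length-++ later) (cong (_+ length (vertices Z)) (length-tabulate (c ∘ suc)))))) ⟩
    length X + (a + length (vertices Z)) + ℓ zero
      ≤⟨ +-mono-≤ (+-monoʳ-≤ (length X) (+-monoʳ-≤ a (≤-trans (length-vertices Z) (*-monoˡ-≤ r (ℓ≤M _))))) (ℓ≤M zero) ⟩
    length X + (a + M * r) + M
      ≤⟨ +-monoˡ-≤ M (+-monoʳ-≤ (length X) (+-monoˡ-≤ (M * r) (≤-trans (m≤m*n a (suc (M * r))) (m≤n+m _ (suc (M * r)))))) ⟩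
    length X + (suc a * suc (M * r) + M * r) + M
      ≡⟨ trans (+-assoc (length X) _ M) (cong (length X +_) (+-assoc (suc a * suc (M * r)) (M * r) M)) ⟩
    length X + (suc a * suc (M * r) + (M * r + M))
      ≤⟨ bound ⟩
    L ∎
    where open ≤-Reasoning
  first : Σ (Sunflower G (c zero) (ℓ zero)) λ F → ∀ j {x} → x ∈ˡ forbidden → x ∉ petal F j
  first = avoiding (ℓ zero) forbidden small c₀∉ (big zero)
  F = proj₁ first
  X′ = X ++ vertices F
  c∉X′ : ∀ i → c (suc i) ∉ˡ X′
  c∉X′ i p with ∈-++⁻ X p
  ... | inj₁ q = c∉X (suc i) q
  ... | inj₂ q with ∈-vertices⁻ F q
  ...   | j , x∈ = proj₂ first j (∈-++⁺ʳ X (∈-++⁺ˡ (∈-tabulate⁺ i))) x∈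
  X′∉Z : ∀ j {x} → x ∈ˡ X′ → x ∉ petal Z j
  X′∉Z j p x∈Z with ∈-++⁻ X p
  ... | inj₁ q = X∉Z j q x∈Z
  ... | inj₂ q with ∈-vertices⁻ F q
  ...   | i , x∈ = proj₂ first i (∈-++⁺ʳ X (∈-++⁺ʳ later (∈-vertices⁺ Z j x∈Z))) x∈
  bound′ : length X′ + (a * suc (M * r) + (M * r + M)) ≤ L
  bound′ = begin
    length X′ + (a * suc (M * r) + (M * r + M))
      ≡⟨ cong (_+ _) (length-++ X) ⟩
    length X + length (vertices F) + (a * suc (M * r) + (M * r + M))
      ≤⟨ +-monoˡ-≤ _ (+-monoʳ-≤ (length X) (≤-trans (length-vertices F) (≤-trans (*-monoˡ-≤ r (ℓ≤M zero)) (n≤1+n _)))) ⟩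
    length X + suc (M * r) + (a * suc (M * r) + (M * r + M))
      ≡⟨ trans (+-assoc (length X) _ _) (cong (length X +_) (sym (+-assoc (suc (M * r)) _ _))) ⟩
    length X + (suc a * suc (M * r) + (M * r + M))
      ≤⟨ bound ⟩
    L ∎
    where open ≤-Reasoning
  rest : Σ (Forest G (suc a) (ℓ ∘ suc)) λ 𝓕 → ∀ i j {x} → x ∈ˡ X′ → x ∉ petal (starAt 𝓕 i) j
  rest = greedy-forest L M (ℓ ∘ suc) (ℓ≤M ∘ suc) (c ∘ suc) (Fin-suc-injective ∘ c-inj) (big ∘ suc) Z (c∉Z ∘ suc) X′ c∉X′ X′∉Z bound′
  𝓡 = proj₁ rest
  centres : Fin (suc (suc a)) → Fin n
  centres zero    = c zero
  centres (suc i) = centre 𝓡 i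
  stars : ∀ i → Sunflower G (centres i) (ℓ i)
  stars zero    = F
  stars (suc i) = starAt 𝓡 i
  disj : ∀ i i′ j j′ {x} → x ∈ petal (stars i) j → x ∈ petal (stars i′) j′ → i ≡ i′
  disj zero    zero     j j′ p q = refl
  disj zero    (suc i′) j j′ p q = contradiction q (proj₂ rest i′ j′ (∈-++⁺ʳ X (∈-vertices⁺ F j p)))
  disj (suc i) zero     j j′ p q = contradiction p (proj₂ rest i j (∈-++⁺ʳ X (∈-vertices⁺ F j′ q)))
  disj (suc i) (suc i′) j j′ p q = cong suc (disjoint 𝓡 p q)
  forest : Forest G (suc (suc a)) ℓ
  forest = record { centre = centres ; starAt = stars ; disjoint = λ {i} {i′} {j} {j′} → disj i i′ j j′ }
  avoids : ∀ i j {x} → x ∈ˡ X → x ∉ petal (stars i) j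
  avoids zero    j x∈X = proj₂ first j (∈-++⁺ˡ x∈X)
  avoids (suc i) j x∈X = proj₂ rest i j (∈-++⁺ˡ x∈X)

-- Covers of the edges through a vertex, and deciding sunflowers

Cover : RGraph r n → Fin n → List (Fin n) → Set
Cover G v C = ∀ {e} → T (edge G e) → v ∈ e → ∃ λ u → u ∈ e × u ≢ v × u ∈ˡ C

-- Petals are added one at a time. If no edge can be added, every edge through `v` meets the current
-- petals outside `v`, so their union is a cover.
sunflower-or-cover : (G : RGraph r n) (v : Fin n) (L : ℕ) →
  Sunflower G v L ⊎ (∃ λ C → length C ≤ L * r × Cover G v C)
sunflower-or-cover G v zero    = inj₁ record { petal = λ () ; petal-edge = λ () ; core = λ () ; meet = λ { {()} } }
sunflower-or-cover {r} {n} G v (suc L) with sunflower-or-cover G v L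
... | inj₂ (C , len , cover) = inj₂ (C , ≤-trans len (m≤n+m (L * r) r) , cover)
... | inj₁ F with anySubset? (λ e → T? (edge G e) ×-dec v ∈? e ×-dec ¬? (hits? e))
  where
  hits? : (e : Subset n) → Dec (∃ λ u → u ∈ e × u ≢ v × u ∈ˡ vertices F)
  hits? e = any? (λ u → u ∈? e ×-dec ¬? (u ≟ v) ×-dec Any.any? (u ≟_) (vertices F))
...   | no ¬p = inj₂ (vertices F , ≤-trans (length-vertices F) (m≤n+m (L * r) r) , λ {e} e-edge v∈e →
  decidable-stable (any? (λ u → u ∈? e ×-dec ¬? (u ≟ v) ×-dec Any.any? (u ≟_) (vertices F)))
    (λ ¬hit → ¬p (e , e-edge , v∈e , ¬hit)))
...   | yes (e , e-edge , v∈e , ¬hit) = inj₁ record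
  { petal = petals ; petal-edge = edges ; core = cores ; meet = λ {i} {j} → meets i j }
  where
  petals : Fin (suc L) → Subset n
  petals zero    = e
  petals (suc j) = petal F j
  edges : ∀ j → T (edge G (petals j))
  edges zero    = e-edge
  edges (suc j) = petal-edge F j
  cores : ∀ j → v ∈ petals j
  cores zero    = v∈e
  cores (suc j) = core F j
  meets : ∀ i j {x} → x ∈ petals i → x ∈ petals j → x ≢ v → i ≡ j
  meets zero    zero    _ _ _   = refl
  meets zero    (suc j) p q x≢v = contradiction (_ , p , x≢v , ∈-vertices⁺ F j q) ¬hit
  meets (suc i) zero    p q x≢v = contradiction (_ , q , x≢v , ∈-vertices⁺ F i p) ¬hit
  meets (suc i) (suc j) p q x≢v = cong suc (meet F p q x≢v)

anyVec? : ∀ {A : Set} → (∀ {P : A → Set} → Decidable P → Dec (∃ P)) →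
          ∀ m {P : Vec A m → Set} → Decidable P → Dec (∃ P)
anyVec? search zero    P? = map′ (λ p → [] , p) (λ { ([] , p) → p }) (P? [])
anyVec? search (suc m) P? = map′ (λ { (x , xs , p) → x ∷ xs , p }) (λ { (x ∷ xs , p) → x , xs , p })
  (search λ x → anyVec? search m λ xs → P? (x ∷ xs))

-- Exhaustive search over `ℓ`-tuples of vertex sets. It makes the big vertices a `Subset` and
-- star-freeness decidable.
sunflower? : (G : RGraph r n) (c : Fin n) (ℓ : ℕ) → Dec (Sunflower G c ℓ)
sunflower? {r} {n} G c ℓ = map′ to from (anyVec? anySubset? ℓ good?)
  where
  Good : Vec (Subset n) ℓ → Set
  Good p = (∀ j → T (edge G (Vec.lookup p j))) × (∀ j → c ∈ Vec.lookup p j) ×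
           (∀ i j x → x ∈ Vec.lookup p i → x ∈ Vec.lookup p j → x ≢ c → i ≡ j)
  good? : Decidable Good
  good? p = all? (λ j → T? (edge G (Vec.lookup p j))) ×-dec all? (λ j → c ∈? Vec.lookup p j) ×-dec
    all? (λ i → all? (λ j → all? (λ x → x ∈? Vec.lookup p i →-dec x ∈? Vec.lookup p j →-dec ¬? (x ≟ c) →-dec i ≟ j)))
  to : ∃ Good → Sunflower G c ℓ
  to (p , edges , cores , meets) =
    record { petal = Vec.lookup p ; petal-edge = edges ; core = cores ; meet = λ {i} {j} {x} → meets i j x }
  from : Sunflower G c ℓ → ∃ Good
  from F = Vec.tabulate (petal F) , (λ j → subst (T ∘ edge G) (sym (at′ j)) (petal-edge F j)) ,
    (λ j → subst (c ∈_) (sym (at′ j)) (core F j)) ,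
    λ i j x p q → meet F (subst (x ∈_) (at′ i) p) (subst (x ∈_) (at′ j) q)
    where
    at′ : ∀ j → Vec.lookup (Vec.tabulate (petal F)) j ≡ petal F j
    at′ = lookup∘tabulate (petal F)

-- Serves twice: a core of `L` petals outside the left part is big in the whole graph, and a star
-- found outside the big vertices avoids them as centres.
extendSunflower : (sh : Shuffle a b n) (G : RGraph r n) {c : Fin b} {ℓ : ℕ} (F : Sunflower (restrict sh G) c ℓ) →
  Σ (Sunflower G (injʳ sh c) ℓ) λ F′ → ∀ j {x} → x ∈ petal F′ j → x ∉ leftPart sh
extendSunflower {a} {b} {n} sh G {c} {ℓ} F = record
  { petal = petals ; petal-edge = petal-edge F ; core = λ j → inside⁺ j (core F j) ; meet = λ {i} {j} → meets i j } , off-left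
  where
  petals : Fin ℓ → Subset n
  petals j = merge sh Subset.⊥ (petal F j)
  inside⁺ : ∀ j {y} → y ∈ petal F j → injʳ sh y ∈ petals j
  inside⁺ j p = injʳ-∈⁺ sh (petals j) (subst (_ ∈_) (sym (right-merge sh _ _)) p)
  inside⁻ : ∀ j {y} → injʳ sh y ∈ petals j → y ∈ petal F j
  inside⁻ j p = subst (_ ∈_) (right-merge sh _ _) (injʳ-∈⁻ sh (petals j) p)
  off-left : ∀ j {x} → x ∈ petals j → x ∉ leftPart sh
  off-left j = merge-⊥-disjoint sh (petal F j)
  meets : ∀ i j {x} → x ∈ petals i → x ∈ petals j → x ≢ injʳ sh c → i ≡ j
  meets i j p q x≢ with injʳ-surjective sh (off-left i p)
  ... | y , refl = meet F (inside⁻ i p) (inside⁻ j q) (λ { refl → x≢ refl })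

-- Cliques in graphs without large sunflowers

tuples : ∀ {A : Set} m → List A → List (Vec A m)
tuples zero    xs = [] ∷ []
tuples (suc m) xs = concatMap (λ x → map (x ∷_) (tuples m xs)) xs

∈-tuples : ∀ {A : Set} {m} {xs : List A} → (∀ x → x ∈ˡ xs) → (ys : Vec A m) → ys ∈ˡ tuples m xs
∈-tuples all∈ []       = here refl
∈-tuples {m = suc m} {xs} all∈ (y ∷ ys) =
  ∈-concatMap⁺′ (λ x → map (x ∷_) (tuples m xs)) (all∈ y) (∈-map⁺ (y ∷_) (∈-tuples all∈ ys))

length-tuples : ∀ {A : Set} m (xs : List A) → length (tuples m xs) ≤ length xs ^ m
length-tuples zero    xs = ≤-refl
length-tuples (suc m) xs = length-concatMap≤ _ _
  (λ x → subst (_≤ length xs ^ m) (sym (length-map (x ∷_) (tuples m xs))) (length-tuples m xs)) xs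

-- For generators only containment matters, so shorter lists can be filled up with an arbitrary
-- vertex and counted as tuples of one length.
padTo : ∀ {A : Set} m → A → (xs : List A) → length xs ≤ m → ∃ λ (v : Vec A m) → ∀ {x} → x ∈ˡ xs → x ∈ˡ Vec.toList v
padTo zero    a []       _        = [] , λ ()
padTo (suc m) a []       _        = Vec.replicate (suc m) a , λ ()
padTo (suc m) a (x ∷ xs) (s≤s le) with padTo m a xs le
... | v , sub = x ∷ v , λ { (here refl) → here refl ; (there p) → there (sub p) }

sublists : ∀ {A : Set} → List A → List (List A)
sublists []       = [] ∷ []
sublists (x ∷ xs) = map (x ∷_) (sublists xs) ++ sublists xs

length-sublists : ∀ {A : Set} (xs : List A) → length (sublists xs) ≡ 2 ^ length xs
length-sublists []       = refl
length-sublists (x ∷ xs) = begin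
  length (map (x ∷_) (sublists xs) ++ sublists xs)         ≡⟨ length-++ (map (x ∷_) (sublists xs)) ⟩
  length (map (x ∷_) (sublists xs)) + length (sublists xs) ≡⟨ cong (_+ length (sublists xs)) (length-map (x ∷_) (sublists xs)) ⟩
  length (sublists xs) + length (sublists xs)              ≡⟨ cong₂ _+_ (length-sublists xs) (trans (length-sublists xs) (sym (+-identityʳ _))) ⟩
  2 ^ suc (length xs)                                      ∎
  where open ≡-Reasoning

filter∈sublists : ∀ {A : Set} {P : A → Set} (P? : Decidable P) xs → filter P? xs ∈ˡ sublists xs
filter∈sublists P? []       = here refl
filter∈sublists P? (x ∷ xs) with P? x
... | yes _ = ∈-++⁺ˡ (∈-map⁺ (x ∷_) (filter∈sublists P? xs))
... | no  _ = ∈-++⁺ʳ (map (x ∷_) (sublists xs)) (filter∈sublists P? xs)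

module _ {n p c : ℕ} (H : RGraph (3 + p) n) (N : Fin n → List (Fin n)) (N≤c : ∀ v → length (N v) ≤ c)
         (cover : ∀ v → Cover H v (N v)) where

  private
    close : List (Fin n) → List (Fin n)
    close X = X ++ concatMap N X

    -- Up to two steps may be needed to reach `v`, and one more step adds `N v`.
    close³ : List (Fin n) → List (Fin n)
    close³ X = close (close (close X))

    close⁰ : ∀ {X x} → x ∈ˡ X → x ∈ˡ close X
    close⁰ = ∈-++⁺ˡ

    close¹ : ∀ {X y x} → y ∈ˡ X → x ∈ˡ N y → x ∈ˡ close X
    close¹ {X} y∈ x∈ = ∈-++⁺ʳ X (∈-concatMap⁺′ N y∈ x∈)

    length-close : ∀ X → length (close X) ≤ length X * suc c
    length-close X = begin
      length (X ++ concatMap N X)          ≡⟨ length-++ X ⟩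
      length X + length (concatMap N X)    ≤⟨ +-monoʳ-≤ (length X) (length-concatMap≤ N c N≤c X) ⟩
      length X + length X * c              ≡⟨ sym (*-suc (length X) c) ⟩
      length X * suc c                     ∎
      where open ≤-Reasoning

    length-close³ : ∀ X → length (close³ X) ≤ length X * suc c * suc c * suc c
    length-close³ X = ≤-trans (length-close (close (close X))) (*-monoˡ-≤ (suc c)
      (≤-trans (length-close (close X)) (*-monoˡ-≤ (suc c) (length-close X))))

    _∈N?_ : ∀ (x v : Fin n) → Dec (x ∈ˡ N v)
    x ∈N? v = Any.any? (x ≟_) (N v)

    Spans : List (Fin n) → Subset n → Set
    Spans X S = ∀ {x} → x ∈ S → x ∈ˡ close³ X

  module _ (S : Subset n) (clique : IsClique H S) (large : 3 + p ≤ ∣ S ∣) where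

    private
      edge-of : ∀ {xs} → Unique xs → length xs ≡ 3 + p → (∀ {x} → x ∈ˡ xs → x ∈ S) → T (edge H (fromList xs))
      edge-of {xs} u len sub = clique (trans (∣fromList∣ u) len) (sub ∘ ∈-fromList⁻ xs)

      some : ∃ λ v → v ∈ S
      some with outside-list S [] (≤-trans (s≤s z≤n) large)
      ... | v , v∈S , _ = v , v∈S

      v = proj₁ some
      v∈S = proj₂ some

      missed? : Decidable (λ x → x ≢ v × x ∉ˡ N v)
      missed? x = ¬? (x ≟ v) ×-dec ¬? (x ∈N? v)

      W : List (Fin n)
      W = filter missed? (elements S)

      W-unique : Unique W
      W-unique = Unique.filter⁺ missed? (elements-unique S)

      W⁻ : ∀ {x} → x ∈ˡ W → x ∈ S × x ≢ v × x ∉ˡ N v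
      W⁻ x∈ with ∈-filter⁻ missed? {xs = elements S} x∈
      ... | x∈S , x≢v , x∉C = ∈-elements⁻ S x∈S , x≢v , x∉C

      trichotomy : ∀ {x} → x ∈ S → x ≡ v ⊎ x ∈ˡ N v ⊎ x ∈ˡ W
      trichotomy {x} x∈S with x ≟ v | x ∈N? v
      ... | yes x≡v | _       = inj₁ x≡v
      ... | no _    | yes x∈C = inj₂ (inj₁ x∈C)
      ... | no x≢v  | no x∉C  = inj₂ (inj₂ (∈-filter⁺ missed? (∈-elements⁺ S x∈S) (x≢v , x∉C)))

      spans : ∀ X → v ∈ˡ close (close X) → (∀ {x} → x ∈ˡ W → x ∈ˡ close³ X) → Spans X S
      spans X v∈ W⊆ x∈S with trichotomy x∈S
      ... | inj₁ refl        = close⁰ v∈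
      ... | inj₂ (inj₁ x∈C)  = close¹ v∈ x∈C
      ... | inj₂ (inj₂ x∈W)  = W⊆ x∈W

      -- Trades `y` for `v`. For `y` in `W` the list is no longer than `W`, so it can generate `S`
      -- once `y` is reachable from it.
      without : Fin n → List (Fin n)
      without y = v ∷ filter (λ x → ¬? (x ≟ y)) W

      without-spans : ∀ {y} → y ∈ˡ close (close (without y)) → Spans (without y) S
      without-spans {y} y∈ = spans (without y) (close⁰ (close⁰ {without y} (here refl))) W⊆
        where
        W⊆ : ∀ {x} → x ∈ˡ W → x ∈ˡ close³ (without y)
        W⊆ {x} x∈ with x ≟ y
        ... | yes refl = close⁰ y∈
        ... | no x≢y   = close⁰ (close⁰ (close⁰ (there (∈-filter⁺ (λ x → ¬? (x ≟ y)) x∈ x≢y))))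

      length-without : ∀ {y} → y ∈ˡ W → length W ≡ suc p → length (without y) ≤ suc p
      length-without {y} y∈ len = subst (length (without y) ≤_) len
        (filter-notAll (λ x → ¬? (x ≟ y)) W (Any.map (λ { refl ¬≢ → ¬≢ refl }) y∈))

      Generators : Set
      Generators = ∃ λ X → length X ≤ suc p × Spans X S

      few : length W ≤ p → Generators
      few le = v ∷ W , s≤s le , spans (v ∷ W) (close⁰ (close⁰ {v ∷ W} (here refl))) (λ x∈ → close⁰ (close⁰ (close⁰ (there x∈))))

      -- v and r − 1 vertices of W would form an edge which N v misses.
      W-small : length W ≤ suc p
      W-small = ≮⇒≥ λ lt → bad lt
        where
        bad : ¬ (suc p < length W)
        bad lt with cover v (edge-of {v ∷ W′} (All.tabulate (λ x∈ v≡x → proj₁ (proj₂ (W⁻ (W′⊆ x∈))) (sym v≡x)) ∷ Unique.take⁺ (2 + p) W-unique)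
                       (cong suc (trans (length-take (2 + p) W) (m≤n⇒m⊓n≡m lt)))
                       (λ { (here refl) → v∈S ; (there x∈) → proj₁ (W⁻ (W′⊆ x∈)) }))
                       (∈-fromList⁺ {xs = v ∷ W′} (here refl))
          where
          W′ = take (2 + p) W
          W′⊆ : ∀ {x} → x ∈ˡ W′ → x ∈ˡ W
          W′⊆ x∈ = subst (_ ∈ˡ_) (take++drop≡id (2 + p) W) (∈-++⁺ˡ x∈)
        ... | u , u∈e , u≢v , u∈C with ∈-fromList⁻ (v ∷ take (2 + p) W) u∈e
        ...   | here refl = u≢v refl
        ...   | there u∈  = proj₂ (proj₂ (W⁻ (subst (_ ∈ˡ_) (take++drop≡id (2 + p) W) (∈-++⁺ˡ u∈)))) u∈C

      -- Now `v ∷ W` has `r - 1` vertices, so `S` has a further vertex `u`, and `u`, `v` and `W`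
      -- form an edge. Each vertex `x` of this edge has another one in `N x`. Following these arrows
      -- from `u`, either some `y` in `W` is reached from the others and can be traded for `v`, or
      -- `v` is reached from `W` and can be left out.
      exact : length W ≡ suc p → Generators
      exact len with outside-list S (v ∷ W) (subst (λ m → suc m < ∣ S ∣) (sym len) large)
      ... | u , u∈S , u∉ = from-u
        where
        e : List (Fin n)
        e = u ∷ v ∷ W
        e-edge : T (edge H (fromList e))
        e-edge = edge-of
          (All.tabulate (λ { x∈ refl → u∉ x∈ }) ∷ All.tabulate (λ { x∈ refl → proj₁ (proj₂ (W⁻ x∈)) refl }) ∷ W-unique)
          (cong (2 +_) len)
          (λ { (here refl) → u∈S ; (there (here refl)) → v∈S ; (there (there x∈)) → proj₁ (W⁻ x∈) })
        u∈Cv : u ∈ˡ N v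
        u∈Cv with trichotomy u∈S
        ... | inj₁ refl       = contradiction (here refl) u∉
        ... | inj₂ (inj₁ x∈)  = x∈
        ... | inj₂ (inj₂ x∈)  = contradiction (there x∈) u∉
        next : ∀ {x} → x ∈ˡ e → ∃ λ y → y ∈ˡ e × y ≢ x × y ∈ˡ N x
        next {x} x∈ with cover x e-edge (∈-fromList⁺ x∈)
        ... | y , y∈ , y≢ , y∈C = y , ∈-fromList⁻ e y∈ , y≢ , y∈C
        drop-y : ∀ {y} → y ∈ˡ W → y ∈ˡ close (close (without y)) → Generators
        drop-y {y} y∈ reach = without y , length-without y∈ len , without-spans reach
        drop-v : v ∈ˡ close (close W) → Generators
        drop-v reach = W , ≤-reflexive len , spans W reach (close⁰ ∘ close⁰ ∘ close⁰)
        -- The arrow from `w` ends in `u`, which leads on to `v`, or in `v` itself, or in another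
        -- vertex `y` of `W`.
        from-w : ∀ {w} → w ∈ˡ W → v ∈ˡ N u → Generators
        from-w {w} w∈ v∈Cu with next (there (there w∈))
        ... | _ , here refl , _ , u∈C           = drop-v (close¹ (close¹ w∈ u∈C) v∈Cu)
        ... | _ , there (here refl) , _ , v∈C   = drop-v (close⁰ (close¹ w∈ v∈C))
        ... | y , there (there y∈) , y≢w , y∈C  = drop-y y∈
          (close⁰ (close¹ (there (∈-filter⁺ (λ x → ¬? (x ≟ y)) w∈ (λ { refl → y≢w refl }))) y∈C))
        -- `W` has `r - 2` elements, at least one since `r ≥ 3`.
        w₀ : ∃ λ w → w ∈ˡ W
        w₀ = nonempty W len
          where
          nonempty : ∀ xs → length xs ≡ suc p → ∃ λ w → w ∈ˡ xs
          nonempty (w ∷ _) _ = w , here refl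
        from-u : Generators
        from-u with next (here refl)
        ... | _ , here refl , u≢u , _           = contradiction refl u≢u
        ... | _ , there (here refl) , _ , v∈Cu  = from-w (proj₂ w₀) v∈Cu
        ... | y , there (there y∈) , _ , y∈Cu   = drop-y y∈ (close¹ (close¹ {without y} (here refl) u∈Cv) y∈Cu)

      generators : Generators
      generators with length W ≤? p
      ... | yes le = few le
      ... | no ¬le = exact (≤-antisym W-small (≰⇒> ¬le))

    spanning-tuple : ∃ λ (X : Vec (Fin n) (suc p)) → Spans (Vec.toList X) S
    spanning-tuple with generators
    ... | X , len , span with padTo (suc p) v X len
    ...   | Y , X⊆Y = Y , λ x∈ → mono (mono (mono X⊆Y)) (span x∈)
      where
      mono : ∀ {Y Z} → (∀ {x} → x ∈ˡ Y → x ∈ˡ Z) → ∀ {x} → x ∈ˡ close Y → x ∈ˡ close Z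
      mono {Y} Y⊆Z x∈ with ∈-++⁻ Y x∈
      ... | inj₁ x∈Y = close⁰ (Y⊆Z x∈Y)
      ... | inj₂ x∈C with find (∈-concatMap⁻ N {xs = Y} x∈C)
      ...   | y , y∈ , x∈Cy = close¹ (Y⊆Z y∈) x∈Cy

  -- Every such clique is a subset of the third closure of an `(r - 2)`-tuple. There are
  -- `n ^ (r - 2)` tuples, and the size of a closure is bounded in terms of `p` and `c`.
  few-cliques : ∀ i → 3 + p ≤ i → NK i H ≤ 2 ^ (suc p * suc c * suc c * suc c) * n ^ suc p
  few-cliques i r≤i = begin
    NK i H                     ≤⟨ Unique-⊆⇒length≤ (Unique.filter⁺ (T? ∘ isCopyOfK H i) (allSubsets-unique n)) listed ⟩
    length (concatMap spanned all-tuples)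
                               ≤⟨ length-concatMap≤ spanned K spanned≤ all-tuples ⟩
    length all-tuples * K      ≤⟨ *-monoˡ-≤ K (subst (λ m → length all-tuples ≤ m ^ suc p) (length-tabulate {n = n} id) (length-tuples (suc p) (allFin n))) ⟩
    n ^ suc p * K              ≡⟨ *-comm (n ^ suc p) K ⟩
    K * n ^ suc p              ∎
    where
    open ≤-Reasoning
    K = 2 ^ (suc p * suc c * suc c * suc c)
    all-tuples : List (Vec (Fin n) (suc p))
    all-tuples = tuples (suc p) (allFin n)
    spanned : Vec (Fin n) (suc p) → List (Subset n)
    spanned X = map fromList (sublists (close³ (Vec.toList X)))
    spanned≤ : ∀ X → length (spanned X) ≤ K
    spanned≤ X = begin
      length (spanned X)                          ≡⟨ length-map fromList (sublists (close³ (Vec.toList X))) ⟩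
      length (sublists (close³ (Vec.toList X)))   ≡⟨ length-sublists (close³ (Vec.toList X)) ⟩
      2 ^ length (close³ (Vec.toList X))          ≤⟨ ^-monoʳ-≤ 2 (subst (λ m → length (close³ (Vec.toList X)) ≤ m * suc c * suc c * suc c) (length-toList X) (length-close³ (Vec.toList X))) ⟩
      K                                           ∎
    listed : ∀ {S} → S ∈ˡ filterᵇ (isCopyOfK H i) (allSubsets n) → S ∈ˡ concatMap spanned all-tuples
    listed {S} S∈ with T-∧⁻ {∣ S ∣ ≡ᵇ i} (proj₂ (∈-filter⁻ (T? ∘ isCopyOfK H i) {xs = allSubsets n} S∈))
    ... | size , cl with spanning-tuple S (isClique?⁻ H S cl) (subst (3 + p ≤_) (sym (≡ᵇ⇒≡ ∣ S ∣ i size)) r≤i)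
    ...   | X , span = ∈-concatMap⁺′ spanned (∈-tuples ∈-allFin X)
      (subst (_∈ˡ spanned X) recover (∈-map⁺ fromList (filter∈sublists (_∈? S) (close³ (Vec.toList X)))))
      where
      recover : fromList (filter (_∈? S) (close³ (Vec.toList X))) ≡ S
      recover = ⊆-antisym (λ x∈ → proj₂ (∈-filter⁻ (_∈? S) {xs = close³ (Vec.toList X)} (∈-fromList⁻ _ x∈)))
                          (λ x∈ → ∈-fromList⁺ (∈-filter⁺ (_∈? S) (span x∈) x∈))

-- The constant `K` is fixed before the graph and the clique size, so it depends on neither.
CliqueBound : ℕ → ℕ → ℕ → Set
CliqueBound p c K = ∀ {n} (H : RGraph (3 + p) n) → (∀ v → ∃ λ C → length C ≤ c × Cover H v C) →
  ∀ i → 3 + p ≤ i → NK i H ≤ K * n ^ suc p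

cliqueBound : ∀ p c → ∃ (CliqueBound p c)
cliqueBound p c = 2 ^ (suc p * suc c * suc c * suc c) , λ H cov → few-cliques H (proj₁ ∘ cov) (proj₁ ∘ proj₂ ∘ cov) (λ v → proj₂ (proj₂ (cov v)))

-- Growth of binomial coefficients

absorption : ∀ m k → suc k * (suc m C suc k) ≡ suc m * (m C k)
absorption m zero = trans (trans (+-identityʳ _) (nC1≡n (suc m))) (sym (trans (cong (suc m *_) (nC0≡1 m)) (*-identityʳ (suc m))))
absorption zero (suc k) = trans (cong (suc (suc k) *_) (k>n⇒nCk≡0 {1} {suc (suc k)} (s≤s (s≤s z≤n)))) (*-zeroʳ (suc (suc k)))
absorption (suc m) (suc k) = begin
  suc (suc k) * (suc (suc m) C suc (suc k))
    ≡⟨ cong (suc (suc k) *_) (sym (nCk+nC[k+1]≡[n+1]C[k+1] (suc m) (suc k))) ⟩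
  suc (suc k) * (x + y)
    ≡⟨ expand (suc k) x y ⟩
  x + (suc k * x + suc (suc k) * y)
    ≡⟨ cong (x +_) (cong₂ _+_ (absorption m k) (absorption m (suc k))) ⟩
  x + (suc m * (m C k) + suc m * (m C suc k))
    ≡⟨ cong (x +_) (trans (sym (*-distribˡ-+ (suc m) (m C k) (m C suc k))) (cong (suc m *_) (nCk+nC[k+1]≡[n+1]C[k+1] m k))) ⟩
  suc (suc m) * x ∎
  where
  open ≡-Reasoning
  x = suc m C suc k
  y = suc m C suc (suc k)
  expand : ∀ k x y → suc k * (x + y) ≡ x + (k * x + suc k * y)
  expand = solve-∀

-- The right side is the product of `m + 1` up to `m + q`, and each factor exceeds `m`.
^≤!*C : ∀ m q → m ^ q ≤ q ! * ((m + q) C q)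
^≤!*C m zero = ≤-reflexive (sym (trans (+-identityʳ _) (nC0≡1 (m + 0))))
^≤!*C m (suc q) = begin
  m * m ^ q                                 ≤⟨ *-mono-≤ (m≤n⇒m≤1+n (m≤m+n m q)) (^≤!*C m q) ⟩
  suc (m + q) * (q ! * ((m + q) C q))       ≡⟨ swap (suc (m + q)) (q !) ((m + q) C q) ⟩
  q ! * (suc (m + q) * ((m + q) C q))       ≡⟨ cong (q ! *_) (sym (absorption (m + q) q)) ⟩
  q ! * (suc q * (suc (m + q) C suc q))     ≡⟨ assoc (q !) (suc q) (suc (m + q) C suc q) ⟩
  suc q ! * (suc (m + q) C suc q)           ≡⟨ cong (λ x → suc q ! * (x C suc q)) (sym (+-suc m q)) ⟩
  suc q ! * ((m + suc q) C suc q)           ∎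
  where
  open ≤-Reasoning
  swap : ∀ x y z → x * (y * z) ≡ y * (x * z)
  swap = solve-∀
  assoc : ∀ x y z → x * (y * z) ≡ y * x * z
  assoc = solve-∀

^-distribʳ-* : ∀ q x y → (x * y) ^ q ≡ x ^ q * y ^ q
^-distribʳ-* zero    x y = refl
^-distribʳ-* (suc q) x y = trans (cong (x * y *_) (^-distribʳ-* q x y)) (swap x y (x ^ q) (y ^ q))
  where
  swap : ∀ x y z w → x * y * (z * w) ≡ x * z * (y * w)
  swap = solve-∀

-- For `m ≥ 1` the base satisfies `m + t ≤ (t + 1) * m`.
shifted-power : ∀ m t q → 1 ≤ m → (m + t) ^ q ≤ suc t ^ q * m ^ q
shifted-power m t q 1≤m = begin
  (m + t) ^ q            ≤⟨ ^-monoˡ-≤ q (+-monoʳ-≤ m (m≤m*n t m {{>-nonZero 1≤m}})) ⟩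
  (suc t * m) ^ q        ≡⟨ ^-distribʳ-* q (suc t) m ⟩
  suc t ^ q * m ^ q      ∎
  where open ≤-Reasoning

C-lower : ∀ q t n → suc q + t ≤ n → n ^ q ≤ (suc (q + t) ^ q * q !) * ((n ∸ t) C q)
C-lower q t n le = begin
  n ^ q                                       ≡⟨ cong (_^ q) (sym n≡) ⟩
  (m + (q + t)) ^ q                           ≤⟨ shifted-power m (q + t) q 1≤m ⟩
  suc (q + t) ^ q * m ^ q                     ≤⟨ *-monoʳ-≤ (suc (q + t) ^ q) (^≤!*C m q) ⟩
  suc (q + t) ^ q * (q ! * ((m + q) C q))     ≡⟨ sym (*-assoc (suc (q + t) ^ q) (q !) _) ⟩
  suc (q + t) ^ q * q ! * ((m + q) C q)       ≡⟨ cong (λ x → suc (q + t) ^ q * q ! * (x C q)) (sym n∸t≡) ⟩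
  suc (q + t) ^ q * q ! * ((n ∸ t) C q)       ∎
  where
  open ≤-Reasoning
  -- Chosen so that `n - t = m + q`, the shape that `^≤!*C` asks for; returning from `m` to `n`
  -- costs the constant of `shifted-power`.
  m = n ∸ (q + t)
  n≡ : m + (q + t) ≡ n
  n≡ = m∸n+n≡m (≤-trans (n≤1+n _) le)
  1≤m : 1 ≤ m
  1≤m = m<n⇒0<n∸m le
  n∸t≡ : n ∸ t ≡ m + q
  n∸t≡ = trans (cong (_∸ t) (trans (sym n≡) (sym (+-assoc m q t)))) (m+n∸n≡m (m + q) t)

-- The binomial has one degree more in `b` than the left side. `D` is the cost of replacing `suc b`
-- by `m = b - (q + 1)`, and `N₁` is large enough for one factor `m` to absorb all constants.
C-dominates : ∀ K q → Σ ℕ λ N₀ → ∀ b → N₀ ≤ b → K * suc b ^ q ≤ b C suc q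
C-dominates K q = N₁ + suc q , dominates
  where
  D = suc (suc (suc q)) ^ q
  N₁ = suc (suc q ! * (K * D))
  dominates : ∀ b → N₁ + suc q ≤ b → K * suc b ^ q ≤ b C suc q
  dominates b le = *-cancelˡ-≤ (suc q !) {{(suc q) !≢0}} (begin
    suc q ! * (K * suc b ^ q)                     ≡⟨ cong (λ x → suc q ! * (K * x ^ q)) (sym b≡) ⟩
    suc q ! * (K * (m + suc (suc q)) ^ q)         ≤⟨ *-monoʳ-≤ (suc q !) (*-monoʳ-≤ K (shifted-power m (suc (suc q)) q (≤-trans (s≤s z≤n) N₁≤m))) ⟩
    suc q ! * (K * (D * m ^ q))                   ≡⟨ assoc (suc q !) K D (m ^ q) ⟩
    suc q ! * (K * D) * m ^ q                     ≤⟨ *-monoˡ-≤ (m ^ q) (≤-trans (n≤1+n _) N₁≤m) ⟩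
    m * m ^ q                                     ≤⟨ ^≤!*C m (suc q) ⟩
    suc q ! * ((m + suc q) C suc q)               ≡⟨ cong (λ x → suc q ! * (x C suc q)) (m∸n+n≡m (≤-trans (m≤n+m _ N₁) le)) ⟩
    suc q ! * (b C suc q)                         ∎)
    where
    open ≤-Reasoning
    m = b ∸ suc q
    N₁≤m : N₁ ≤ m
    N₁≤m = subst (_≤ m) (m+n∸n≡m N₁ (suc q)) (∸-monoˡ-≤ (suc q) le)
    b≡ : m + suc (suc q) ≡ suc b
    b≡ = trans (+-suc m (suc q)) (cong suc (m∸n+n≡m (≤-trans (m≤n+m _ N₁) le)))
    assoc : ∀ w x y z → w * (x * (y * z)) ≡ w * (x * y) * z
    assoc = solve-∀

-- Σ_{i<r} counts the s-sets with fewer than r points on the right; moving one point from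
-- the right to the left gains the s-sets through it with exactly r points on the right.
move-one : ∀ a b s r → suc r ≤ s →
  Σ< (suc r) (λ i → (a C (s ∸ i)) * (suc b C i)) + (a C (s ∸ suc r)) * (b C r) ≡
  Σ< (suc r) (λ i → (suc a C (s ∸ i)) * (b C i))
move-one a b (suc s) zero (s≤s z≤n) rewrite nC0≡1 b | nC0≡1 (suc b) | sym (nCk+nC[k+1]≡[n+1]C[k+1] a s) =
  simp (a C suc s) (a C s)
  where
  simp : ∀ x y → 0 + x * 1 + y * 1 ≡ 0 + (y + x) * 1
  simp = solve-∀
move-one a b s (suc r) le = begin
  F + x * (suc b C suc r) + w * z     ≡⟨ cong (λ v → F + x * v + w * z) (sym (nCk+nC[k+1]≡[n+1]C[k+1] b r)) ⟩
  F + x * (y + z) + w * z             ≡⟨ regroup F x y z w ⟩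
  (F + x * y) + (w + x) * z           ≡⟨ cong₂ (λ u v → u + v * z) (move-one a b s r (≤-trans (n≤1+n _) le)) pascal ⟩
  _ + (suc a C (s ∸ suc r)) * z       ∎
  where
  open ≡-Reasoning
  F = Σ< (suc r) (λ i → (a C (s ∸ i)) * (suc b C i))
  x = a C (s ∸ suc r)
  y = b C r
  z = b C suc r
  w = a C (s ∸ suc (suc r))
  step : s ∸ suc r ≡ suc (s ∸ suc (suc r))
  step = +-∸-assoc 1 le
  pascal : w + x ≡ suc a C (s ∸ suc r)
  pascal rewrite step = nCk+nC[k+1]≡[n+1]C[k+1] a (s ∸ suc (suc r))
  regroup : ∀ F x y z w → F + x * (y + z) + w * z ≡ (F + x * y) + (w + x) * z
  regroup = solve-∀

-- Existence of maxima

-- Lists every predicate up to pointwise equality, which suffices for properties and counts that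
-- respect it.
predicates : ∀ n → List (Subset n → Bool)
predicates zero    = (λ _ → true) ∷ (λ _ → false) ∷ []
predicates (suc n) = concatMap (λ f → map (glue f) (predicates n)) (predicates n)
  where
  glue : (f g : Subset n → Bool) → Subset (suc n) → Bool
  glue f g (true  ∷ S) = f S
  glue f g (false ∷ S) = g S

predicates-complete : ∀ n (h : Subset n → Bool) → ∃ λ f → f ∈ˡ predicates n × ∀ S → f S ≡ h S
predicates-complete zero h with h [] in eq
... | true  = _ , here refl , λ { [] → sym eq }
... | false = _ , there (here refl) , λ { [] → sym eq }
predicates-complete (suc n) h with predicates-complete n (h ∘ (true ∷_)) | predicates-complete n (h ∘ (false ∷_))
... | f , f∈ , f≡ | g , g∈ , g≡ =
  _ , ∈-concatMap⁺′ _ f∈ (∈-map⁺ _ g∈) , λ { (true ∷ S) → f≡ S ; (false ∷ S) → g≡ S }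

argmax : ∀ {A : Set} {P : A → Set} (P? : Decidable P) (f : A → ℕ) xs →
  (∀ {x} → x ∈ˡ xs → ¬ P x) ⊎ (∃ λ a → P a × ∀ {x} → x ∈ˡ xs → P x → f x ≤ f a)
argmax P? f [] = inj₁ λ ()
argmax P? f (x ∷ xs) with P? x | argmax P? f xs
... | no ¬px | inj₁ none = inj₁ λ { (here refl) → ¬px ; (there p) → none p }
... | no ¬px | inj₂ (a , pa , best) = inj₂ (a , pa , λ { (here refl) px → contradiction px ¬px ; (there p) → best p })
... | yes px | inj₁ none = inj₂ (x , px , λ { (here refl) _ → ≤-refl ; (there p) py → contradiction py (none p) })
... | yes px | inj₂ (a , pa , best) with ≤-total (f x) (f a)
...   | inj₁ fx≤fa = inj₂ (a , pa , λ { (here refl) _ → fx≤fa ; (there p) → best p })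
...   | inj₂ fa≤fx = inj₂ (x , px , λ { (here refl) _ → ≤-refl ; (there p) py → ≤-trans (best p py) fa≤fx })

_≗ᴳ_ : RGraph r n → RGraph r n → Set
G ≗ᴳ H = ∀ S → edge G S ≡ edge H S

IsMax-exists : {P : RGraph r n → Set} → Decidable P → (∀ {G H} → G ≗ᴳ H → P G → P H) →
  (f : RGraph r n → ℕ) → (∀ {G H} → G ≗ᴳ H → f G ≡ f H) → ∃ P → ∃ λ m → IsMax P f m
IsMax-exists {r} {n} {P} P? P-resp f f-resp (G₀ , p₀) =
  conclude (argmax P? f (map graph (predicates n)))
  where
  graph : (Subset n → Bool) → RGraph r n
  -- The size test turns any predicate into an `r`-graph and changes nothing if the predicate
  -- already describes one.
  graph h = record { edge = λ S → h S ∧ (∣ S ∣ ≡ᵇ r) ; uniform = λ S t → ≡ᵇ⇒≡ ∣ S ∣ r (proj₂ (T-∧⁻ {h S} t)) }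
  listed : ∀ G → ∃ λ G′ → G′ ∈ˡ map graph (predicates n) × G ≗ᴳ G′
  listed G with predicates-complete n (edge G)
  ... | h , h∈ , h≡ = graph h , ∈-map⁺ graph h∈ , λ S → T-cong
    (λ t → T-∧⁺ (subst T (sym (h≡ S)) t) (≡⇒≡ᵇ ∣ S ∣ r (uniform G S t)))
    (λ t → subst T (h≡ S) (proj₁ (T-∧⁻ t)))
  conclude : (∀ {G} → G ∈ˡ map graph (predicates n) → ¬ P G) ⊎
             (∃ λ a → P a × ∀ {G} → G ∈ˡ map graph (predicates n) → P G → f G ≤ f a) → ∃ λ m → IsMax P f m
  conclude (inj₁ none) with listed G₀
  ... | G′ , G′∈ , eq = contradiction (P-resp eq p₀) (none G′∈)
  conclude (inj₂ (a , pa , best)) = f a , (a , pa , refl) , λ G pG → bound G pG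
    where
    bound : ∀ G → P G → f G ≤ f a
    bound G pG with listed G
    ... | G′ , G′∈ , eq = subst (_≤ f a) (sym (f-resp eq)) (best G′∈ (P-resp eq pG))

Contains-resp : (F : PHyp) {G H : RGraph r n} → G ≗ᴳ H → Contains F G → Contains F H
Contains-resp F eq (f , f-inj , f-edge) = f , f-inj , λ e → subst T (eq _) (f-edge e)

starEmbedding? : (G : RGraph (suc (suc q)) n) {ℓ : ℕ} → Fin ℓ → Dec (StarEmbedding G ℓ)
starEmbedding? G {ℓ} j₀ = map′ (λ { (_ , F) → proj₁ (embeds j₀ F) }) (λ E → _ , embedding⇒sunflower {G = G} E)
  (any? (λ c → sunflower? G c ℓ))

star-free-max : ∀ {ℓ} → Fin ℓ → (f : RGraph (suc (suc q)) n → ℕ) → (∀ {G H} → G ≗ᴳ H → f G ≡ f H) →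
  ∃ λ m → IsMax (λ G → ¬ StarEmbedding G ℓ) f m
star-free-max {q} {ℓ = ℓ} j₀ f f-resp = IsMax-exists (λ G → ¬? (starEmbedding? G j₀))
  (λ {G} {H} eq ¬G E → ¬G (Contains-resp (expansion (suc (suc q)) (star ℓ)) {H} {G} (sym ∘ eq) E)) f (λ {G} {H} → f-resp {G} {H})
  -- The edgeless graph makes the family nonempty, since the star has the edge `j₀`.
  (record { edge = λ _ → false ; uniform = λ _ () } , λ { (_ , _ , f-edge) → f-edge j₀ })

-- Upper bounds and the construction for (i)

merge-⊥-right : (sh : Shuffle a b n) (S : Subset n) → (∀ {x} → x ∈ S → x ∉ leftPart sh) → merge sh Subset.⊥ (right sh S) ≡ S
merge-⊥-right done     []          off = refl
merge-⊥-right (inˡ sh) (true  ∷ S) off = contradiction here (off here)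
merge-⊥-right (inˡ sh) (false ∷ S) off = cong (false ∷_) (merge-⊥-right sh S (λ p q → off (there p) (there q)))
merge-⊥-right (inʳ sh) (x     ∷ S) off = cong (x ∷_) (merge-⊥-right sh S (λ p q → off (there p) (there q)))

merge-left-⊥ : (sh : Shuffle a b n) (S : Subset n) → merge sh (left sh S) Subset.⊥ ≡ S ∩ leftPart sh
merge-left-⊥ done     []      = refl
merge-left-⊥ (inˡ sh) (x ∷ S) = cong₂ _∷_ (sym (∧-identityʳ x)) (merge-left-⊥ sh S)
merge-left-⊥ (inʳ sh) (x ∷ S) = cong₂ _∷_ (sym (∧-zeroʳ x)) (merge-left-⊥ sh S)

∣left∣ : (sh : Shuffle a b n) (S : Subset n) → ∣ left sh S ∣ ≡ ∣ S ∩ leftPart sh ∣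
∣left∣ {b = b} sh S = begin
  ∣ left sh S ∣                              ≡⟨ sym (+-identityʳ _) ⟩
  ∣ left sh S ∣ + 0                          ≡⟨ cong (∣ left sh S ∣ +_) (sym (∣⊥∣≡0 b)) ⟩
  ∣ left sh S ∣ + ∣ Subset.⊥ {b} ∣           ≡⟨ sym (∣merge∣ sh (left sh S) Subset.⊥) ⟩
  ∣ merge sh (left sh S) Subset.⊥ ∣          ≡⟨ cong ∣_∣ (merge-left-⊥ sh S) ⟩
  ∣ S ∩ leftPart sh ∣                        ∎
  where open ≡-Reasoning

restrictSunflower : ∀ {r} (sh : Shuffle a b n) (H : RGraph r b) {c : Fin n} {ℓ : ℕ} → Fin ℓ → (F : Sunflower (coneOver sh H) c ℓ) →
  (∀ j {x} → x ∈ petal F j → x ∉ leftPart sh) → ∃ λ c′ → Sunflower H c′ ℓ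
restrictSunflower sh H {c} j₀ F off with injʳ-surjective sh (off j₀ (core F j₀))
... | c′ , refl = c′ , record
  { petal      = λ j → right sh (petal F j)
  ; petal-edge = λ j → coneOver-restricts sh H (right sh (petal F j))
                   (subst (T ∘ edge (coneOver sh H)) (sym (merge-⊥-right sh (petal F j) (off j))) (petal-edge F j))
  ; core       = λ j → injʳ-∈⁻ sh (petal F j) (core F j)
  ; meet       = λ {i} {j} p q y≢ → meet F (injʳ-∈⁺ sh (petal F i) p) (injʳ-∈⁺ sh (petal F j) q) (y≢ ∘ injʳ-injective sh)
  }

-- k disjoint stars cannot all meet a set of k − 1 vertices.
star-off : ∀ {r} {G : RGraph r n} {ℓ : Fin (suc a) → ℕ} (𝓕 : Forest G (suc a) ℓ) (U : Subset n) → ∣ U ∣ ≡ a →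
           ∃ λ i → ∀ j {x} → x ∈ petal (starAt 𝓕 i) j → x ∉ U
star-off {n} {a} {r} {G} {ℓ} 𝓕 U ∣U∣≡a with any? (λ i → all? (λ j → all? (λ x → x ∈? petal (starAt 𝓕 i) j →-dec ¬? (x ∈? U))))
... | yes (i , off) = i , λ j {x} → off j x
... | no none = contradiction (subst (suc a ≤_) ∣U∣≡a (subst (_≤ ∣ U ∣) (length-tabulate x) (Unique⇒length≤∣∣ x-unique U x∈U))) (<⇒≱ ≤-refl)
  where
  hit : ∀ i → ∃ λ j → ∃ λ x → x ∈ petal (starAt 𝓕 i) j × x ∈ U
  hit i = decidable-stable (any? (λ j → any? (λ x → x ∈? petal (starAt 𝓕 i) j ×-dec x ∈? U)))
    (λ ¬hit → none (i , λ j x p q → ¬hit (j , x , p , q)))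
  x : Fin (suc a) → Fin n
  x i = proj₁ (proj₂ (hit i))
  x-unique : Unique (tabulate x)
  x-unique = Unique.tabulate⁺ λ {i} {i′} eq →
    disjoint 𝓕 (proj₁ (proj₂ (proj₂ (hit i)))) (subst (_∈ petal (starAt 𝓕 i′) (proj₁ (hit i′))) (sym eq) (proj₁ (proj₂ (proj₂ (hit i′)))))
  x∈U : ∀ {y} → y ∈ˡ tabulate x → y ∈ U
  x∈U y∈ with ∈-tabulate⁻ {f = x} y∈
  ... | i , refl = proj₂ (proj₂ (proj₂ (hit i)))

-- The total weight of the terms with `i ≥ r`, to be multiplied by a common bound on their clique
-- counts.
sumOfBinomials : ℕ → ℕ → ℕ → ℕ
sumOfBinomials a r s = Σ< (suc s ∸ r) (λ j → a C (s ∸ (r + j)))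

-- Separates the main term, which depends only on the order of `H`, from the terms that see its
-- edges.
⊛-small : ∀ {r} (H : RGraph r b) a s → r ≤ s → ((λ i → NK i H) ⊛ a) s ≡
  Σ< r (λ i → (a C (s ∸ i)) * (b C i)) + sumFromTo r s (λ i → (a C (s ∸ i)) * NK i H)
⊛-small {r = r} H a s r≤s = trans (Σ<-sumFromTo r s r≤s term)
  (cong (_+ sumFromTo r s term) (Σ<-cong r (λ i i<r → cong ((a C (s ∸ i)) *_) (NK-small i<r H))))
  where
  term : ℕ → ℕ
  term i = (a C (s ∸ i)) * NK i H

-- Here `r = 3 + p` and `k = suc a`; big means core of `L` petals. `L-large` is the budget of
-- `greedy-forest` with `M = ℓ zero`, the largest star, increased by `a` to cover the centres that
-- the last star avoids in `big-small`.
module UpperBound (p a : ℕ) (ℓ : Fin (suc a) → ℕ) (decreasing : ∀ i j → i F.≤ j → ℓ j ≤ ℓ i) (ℓ≥1 : ∀ i → 1 ≤ ℓ i)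
  (L : ℕ) (L-large : a + (a * suc (ℓ zero * (3 + p)) + (ℓ zero * (3 + p) + ℓ zero)) ≤ L)
  (K : ℕ) (K-bounds : CliqueBound p (L * (3 + p)) K) where

  private
    r₀ M : ℕ
    r₀ = 3 + p
    M = ℓ zero

    ℓ≤M : ∀ i → ℓ i ≤ M
    ℓ≤M i = decreasing zero i z≤n

    j₀ : ∀ i → Fin (ℓ i)
    j₀ i = F.fromℕ< (ℓ≥1 i)

  module _ (G : RGraph r₀ n) (free : ¬ Contains (starForest r₀ (suc a) ℓ) G) where

    big : Subset n
    big = subsetOf (λ v → sunflower? G v L)

    no-forest : (c : Fin a → Fin n) → Injective _≡_ _≡_ c → (∀ i → c i ∈ big) →
                {z : Fin n} (Z : Sunflower G z (ℓ (fromℕ a))) → ¬ (∀ i j → c i ∉ petal Z j)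
    no-forest c c-inj c∈ Z c∉Z = free (forest⇒contains j₀ (proj₁
      (greedy-forest L M ℓ ℓ≤M c c-inj (λ i → ∈-subsetOf⁻ (λ v → sunflower? G v L) (c∈ i)) Z c∉Z [] (λ _ ()) (λ _ ()) (≤-trans (m≤n+m _ a) L-large))))

    -- With `k` big vertices, one of them carries the last star, chosen to avoid the other `k - 1`,
    -- and these serve as the centres of the remaining stars.
    big-small : ∣ big ∣ ≤ a
    big-small = ≮⇒≥ too-many
      where
      too-many : ¬ (a < ∣ big ∣)
      too-many lt with pick big lt
      ... | c , c-inj , c∈ with avoiding (ℓ (fromℕ a)) (tabulate (c ∘ suc)) bound c₀∉ (∈-subsetOf⁻ (λ v → sunflower? G v L) (c∈ zero))
        where
        bound : length (tabulate (c ∘ suc)) + ℓ (fromℕ a) ≤ L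
        bound rewrite length-tabulate (c ∘ suc) =
          ≤-trans (+-monoʳ-≤ a (≤-trans (ℓ≤M _) (≤-trans (m≤n+m M (M * r₀)) (m≤n+m _ (a * suc (M * r₀)))))) L-large
        c₀∉ : c zero ∉ˡ tabulate (c ∘ suc)
        c₀∉ x∈ with ∈-tabulate⁻ x∈
        ... | i , eq with c-inj eq
        ...   | ()
      ...   | Z , avoids = no-forest (c ∘ suc) (Fin-suc-injective ∘ c-inj) (c∈ ∘ suc) Z (λ i j → avoids j (∈-tabulate⁺ i))

    right-star-free : (sh : Shuffle a b n) → leftPart sh ≡ big → ¬ StarEmbedding (restrict sh G) (ℓ (fromℕ a))
    right-star-free sh eq E with pick big (≤-reflexive (trans (sym (∣leftPart∣ sh)) (cong ∣_∣ eq)))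
                               | extendSunflower sh G (embedding⇒sunflower {G = restrict sh G} E)
    ... | c , c-inj , c∈ | Z , off = no-forest c c-inj c∈ Z (λ i j p → off j p (subst (c i ∈_) (sym eq) (c∈ i)))

    -- A sunflower with `L` petals in the remaining graph would extend to `G` and make its core big.
    -- So every remaining vertex has a cover.
    right-few-cliques : ∀ {a′} (sh : Shuffle a′ b n) → big ⊆ leftPart sh → ∀ i → r₀ ≤ i → NK i (restrict sh G) ≤ K * b ^ suc p
    right-few-cliques {b} sh sub = K-bounds H cov
      where
      H = restrict sh G
      cov : ∀ y → ∃ λ C → length C ≤ L * r₀ × Cover H y C
      cov y with sunflower-or-cover H y L
      ... | inj₂ found = found
      ... | inj₁ F = contradiction (sub (∈-subsetOf⁺ (λ v → sunflower? G v L) (proj₁ (extendSunflower sh G F)))) (injʳ∉leftPart sh y)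

    NK≤split : ∀ {a′} (sh : Shuffle a′ b n) s → r₀ ≤ s → NK s G ≤
      Σ< r₀ (λ i → (a′ C (s ∸ i)) * (b C i)) + sumFromTo r₀ s (λ i → (a′ C (s ∸ i)) * NK i (restrict sh G))
    NK≤split {b} {a′} sh s r≤s =
      ≤-trans (NK≤⊛ sh G (restrict sh G) (λ _ t → t) s) (≤-reflexive (⊛-small (restrict sh G) a′ s r≤s))

    NK≤big : ∀ {a′} (sh : Shuffle a′ b n) s → r₀ ≤ s → big ⊆ leftPart sh →
      NK s G ≤ Σ< r₀ (λ i → (a′ C (s ∸ i)) * (b C i)) + sumOfBinomials a′ r₀ s * (K * b ^ suc p)
    NK≤big {b} {a′} sh s r≤s sub = ≤-trans (NK≤split sh s r≤s)
      (+-monoʳ-≤ (Σ< r₀ (λ i → (a′ C (s ∸ i)) * (b C i))) (≤-trans (≤-reflexive (sumFromTo-Σ< r₀ s term)) (≤-trans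
        (Σ<-mono (suc s ∸ r₀) (λ j _ → *-monoʳ-≤ (a′ C (s ∸ (r₀ + j))) (right-few-cliques sh sub (r₀ + j) (m≤m+n r₀ j))))
        (≤-reflexive (Σ<-*ʳ (suc s ∸ r₀) (λ j → a′ C (s ∸ (r₀ + j))) (K * b ^ suc p))))))
      where
      term : ℕ → ℕ
      term i = (a′ C (s ∸ i)) * NK i (restrict sh G)

  -- The size condition for the case of fewer than `k - 1` big vertices: only `a - 1` vertices are
  -- split off there, which leaves `suc b`.
  Dominates : ℕ → ℕ → Set
  Dominates s b = sumOfBinomials (a ∸ 1) r₀ s * K * suc b ^ suc p ≤ b C (2 + p)

  -- Splitting off only `a′ = k - 2` vertices, the main term falls short by the amount in
  -- `move-one`. Its factor `a′ C (s - r)` is positive, so the loss outweighs all terms with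
  -- `i ≥ r`.
  few-big : ∀ s → r₀ ≤ s → ∀ a′ → a ≡ suc a′ → s ∸ r₀ ≤ a′ → ∀ b → Dominates s b →
    (G : RGraph r₀ (a + b)) (free : ¬ Contains (starForest r₀ (suc a) ℓ) G) → ∣ big G free ∣ ≤ a′ →
    NK s G ≤ Σ< r₀ (λ i → (a C (s ∸ i)) * (b C i))
  few-big s r≤s a′ refl s∸r≤a′ b dom G free small = ≤-trans (NK≤big G free sh s r≤s big⊆) (≤-trans
    (+-monoʳ-≤ (Σ< r₀ (λ i → (a′ C (s ∸ i)) * (suc b C i))) tail)
    (≤-reflexive (move-one a′ b s (2 + p) r≤s)))
    where
    super = superset-of-size a′ (big G free) small (≤-trans (n≤1+n a′) (m≤m+n a b))
    split = shuffleAt {a = a′} {suc b} (proj₁ super) (proj₁ (proj₂ super)) (+-suc a′ b)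
    sh = proj₁ split
    big⊆ : big G free ⊆ leftPart sh
    big⊆ x∈ = subst (_ ∈_) (sym (proj₂ split)) (proj₂ (proj₂ super) x∈)
    tail : sumOfBinomials a′ r₀ s * (K * suc b ^ suc p) ≤ (a′ C (s ∸ r₀)) * (b C (2 + p))
    tail = ≤-trans (≤-reflexive (sym (*-assoc (sumOfBinomials a′ r₀ s) K (suc b ^ suc p)))) (≤-trans dom
      (m≤n*m (b C (2 + p)) (a′ C (s ∸ r₀)) {{>-nonZero (C-pos s∸r≤a′)}}))

  -- With exactly `k - 1` big vertices the remaining graph is free of the last star and `m` bounds
  -- its contribution. With fewer, the main term alone is enough.
  upper-i : ∀ s → r₀ ≤ s → s ≤ a + (2 + p) → ∀ b → Dominates s b → ∀ {m} →
    (∀ (H : RGraph r₀ b) → ¬ StarEmbedding H (ℓ (fromℕ a)) → sumFromTo r₀ s (λ i → (a C (s ∸ i)) * NK i H) ≤ m) →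
    (G : RGraph r₀ (a + b)) → ¬ Contains (starForest r₀ (suc a) ℓ) G →
    NK s G ≤ Σ< r₀ (λ i → (a C (s ∸ i)) * (b C i)) + m
  upper-i s r≤s s≤ b dom {m} best G free = [ fewer , exactly ]′ (m≤n⇒m<n∨m≡n (big-small G free))
    where
    fewer : ∣ big G free ∣ < a → NK s G ≤ Σ< r₀ (λ i → (a C (s ∸ i)) * (b C i)) + m
    fewer lt = ≤-trans (few-big s r≤s (a ∸ 1) a≡ bound b dom G free (s≤s⁻¹ (≤-trans lt (≤-reflexive a≡)))) (m≤m+n _ m)
      where
      a≡ : a ≡ suc (a ∸ 1)
      a≡ = sym (m+[n∸m]≡n (≤-trans (s≤s z≤n) lt))
      -- From `s ≤ a + r - 1`; it makes the binomial factor in `few-big` positive.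
      bound : s ∸ r₀ ≤ a ∸ 1
      bound = ≤-trans (∸-monoˡ-≤ r₀ s≤) (≤-trans
        (≤-reflexive (cong (_∸ r₀) (trans (cong (_+ (2 + p)) a≡) (sym (+-suc (a ∸ 1) (2 + p))))))
        (≤-reflexive (m+n∸n≡m (a ∸ 1) r₀)))
    exactly : ∣ big G free ∣ ≡ a → NK s G ≤ Σ< r₀ (λ i → (a C (s ∸ i)) * (b C i)) + m
    exactly eq = ≤-trans (NK≤split G free sh s r≤s)
      (+-monoʳ-≤ (Σ< r₀ (λ i → (a C (s ∸ i)) * (b C i))) (best (restrict sh G) (right-star-free G free sh (proj₂ split))))
      where
      split = shuffleAt {a = a} {b} (big G free) eq refl
      sh = proj₁ split

  upper-ii : ∀ s → r₀ ≤ s → a + r₀ ≤ s → ∀ n → a ≤ n → (G : RGraph r₀ n) → ¬ Contains (starForest r₀ (suc a) ℓ) G →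
    NK s G ≤ sumOfBinomials a r₀ s * K * n ^ suc p
  upper-ii s r≤s a+r≤s n a≤n G free = ≤-trans (NK≤big G free sh s r≤s big⊆) (≤-trans
    (≤-reflexive (cong₂ _+_ (Σ<-zero r₀ vanish) (sym (*-assoc (sumOfBinomials a r₀ s) K ((n ∸ a) ^ suc p)))))
    (*-monoʳ-≤ (sumOfBinomials a r₀ s * K) (^-monoˡ-≤ (suc p) (m∸n≤m n a))))
    where
    super = superset-of-size a (big G free) (big-small G free) a≤n
    split = shuffleAt {a = a} {n ∸ a} (proj₁ super) (proj₁ (proj₂ super)) (m+[n∸m]≡n a≤n)
    sh = proj₁ split
    big⊆ : big G free ⊆ leftPart sh
    big⊆ x∈ = subst (_ ∈_) (sym (proj₂ split)) (proj₂ (proj₂ super) x∈)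
    -- `i < r` and `a + r ≤ s` give `s - i > a`.
    vanish : ∀ i → i < r₀ → (a C (s ∸ i)) * ((n ∸ a) C i) ≡ 0
    vanish i i<r = cong (_* ((n ∸ a) C i)) (k>n⇒nCk≡0 {a} {s ∸ i} (m+n≤o⇒m≤o∸n (suc a)
      (≤-trans (≤-reflexive (sym (+-suc a i))) (≤-trans (+-monoʳ-≤ a i<r) a+r≤s))))

  -- One of the `k` stars misses the `k - 1` vertices on the left and therefore lies in `H`. It has
  -- at least as many petals as the last star, the smallest one.
  cone-forest-free : ∀ b (H : RGraph r₀ b) → ¬ StarEmbedding H (ℓ (fromℕ a)) →
    ¬ Contains (starForest r₀ (suc a) ℓ) (coneOver (initialShuffle a b) H)
  cone-forest-free b H star-free con = star-free (proj₁ (embeds (j₀ (fromℕ a))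
    (shrink (decreasing i (fromℕ a) (≤fromℕ i)) (proj₂ (restrictSunflower sh H (j₀ i) (starAt 𝓕 i) (proj₂ off))))))
    where
    sh = initialShuffle a b
    𝓕 : Forest (coneOver sh H) (suc a) ℓ
    𝓕 = contains⇒forest {G = coneOver sh H} con
    off = star-off 𝓕 (leftPart sh) (∣leftPart∣ sh)
    i = proj₁ off

  attained-i : ∀ b (H : RGraph r₀ b) s → r₀ ≤ s →
    NK s (coneOver (initialShuffle a b) H) ≡ Σ< r₀ (λ i → (a C (s ∸ i)) * (b C i)) + sumFromTo r₀ s (λ i → (a C (s ∸ i)) * NK i H)
  attained-i b H s r≤s = trans
    (NK≡⊛ sh (coneOver sh H) H (coneOver-restricts sh H) (coneOver-cone sh H) s) (⊛-small H a s r≤s)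
    where sh = initialShuffle a b

  part-i : ∀ s → r₀ ≤ s → s ≤ a + (2 + p) → ∀ b → Dominates s b → Σ ℕ λ m →
    IsMax {RGraph r₀ b} (λ G → ¬ StarEmbedding G (ℓ (fromℕ a))) (λ G → sumFromTo r₀ s (λ i → (a C (s ∸ i)) * NK i G)) m ×
    IsEx r₀ (a + b) s (starForest r₀ (suc a) ℓ) (sumFromTo 0 (2 + p) (λ i → (a C (s ∸ i)) * (b C i)) + m)
  part-i s r≤s s≤ b dom with star-free-max (j₀ (fromℕ a)) (λ G → sumFromTo r₀ s (λ i → (a C (s ∸ i)) * NK i G))
    (λ {G} {H} eq → cong sum (map-cong (λ j → cong ((a C (s ∸ (r₀ + j))) *_) (NK-ext (r₀ + j) G H eq)) (upTo (suc s ∸ r₀))))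
  ... | m , max@((H , H-free , H≡m) , best) = m , max ,
    (coneOver (initialShuffle a b) H , cone-forest-free b H H-free ,
      trans (attained-i b H s r≤s) (cong₂ _+_ (sym low) H≡m)) ,
    λ G free → subst (λ x → NK s G ≤ x + m) (sym low) (upper-i s r≤s s≤ b dom best G free)
    where
    low : sumFromTo 0 (2 + p) (λ i → (a C (s ∸ i)) * (b C i)) ≡ Σ< r₀ (λ i → (a C (s ∸ i)) * (b C i))
    low = sumFromTo-Σ< 0 (2 + p) _

-- The lower bound in (ii)

length-concat : ∀ {A : Set} (xss : List (List A)) → length (concat xss) ≡ sum (map length xss)
length-concat []         = refl
length-concat (xs ∷ xss) = trans (length-++ xs) (cong (length xs +_) (length-concat xss))

disjoint-images : ∀ {n} k (m : Fin k → ℕ) (g : ∀ i → Fin (m i) → Fin n) →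
  (∀ i → Injective _≡_ _≡_ (g i)) → (∀ {i i′ j j′} → g i j ≡ g i′ j′ → i ≡ i′) →
  (S : Subset n) → (∀ i j → g i j ∈ S) → sumFin k m ≤ ∣ S ∣
disjoint-images k m g g-inj g-disj S g∈ = subst (_≤ ∣ S ∣) len (Unique⇒length≤∣∣ unique S inS)
  where
  lists = tabulate (λ i → tabulate (g i))
  unique : Unique (concat lists)
  unique = Unique.concat⁺ (All.tabulate⁺ (λ i → Unique.tabulate⁺ (g-inj i)))
    (AllPairs.tabulate⁺ (λ {i} {i′} i≢i′ (p , q) → apart i≢i′ p q))
    where
    apart : ∀ {i i′} → i ≢ i′ → ∀ {x} → x ∈ˡ tabulate (g i) → x ∈ˡ tabulate (g i′) → _
    apart {i} {i′} i≢i′ p q with ∈-tabulate⁻ {f = g i} p | ∈-tabulate⁻ {f = g i′} q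
    ... | j , refl | j′ , eq = i≢i′ (g-disj eq)
  inS : ∀ {x} → x ∈ˡ concat lists → x ∈ S
  inS x∈ with ∈-concat⁻′ lists x∈
  ... | xs , x∈xs , xs∈ with ∈-tabulate⁻ {f = λ i → tabulate (g i)} xs∈
  ...   | i , refl with ∈-tabulate⁻ {f = g i} x∈xs
  ...     | j , refl = g∈ i j
  len : length (concat lists) ≡ sumFin k m
  len = begin
    length (concat lists)                                 ≡⟨ length-concat lists ⟩
    sum (map length lists)                                ≡⟨ cong sum (map-tabulate (λ i → tabulate (g i)) length) ⟩
    sum (tabulate (λ i → length (tabulate (g i))))        ≡⟨ cong sum (tabulate-cong (λ i → length-tabulate (g i))) ⟩
    sum (tabulate m)                                      ≡⟨ cong sum (sym (map-tabulate id m)) ⟩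
    sumFin k m                                            ∎
    where open ≡-Reasoning

-- Each petal has a vertex of A other than the core; one more is the core itself or, if the
-- core is not in A, a second vertex of the petal j₀.
transversal : ∀ {r n ℓ} {G : RGraph r n} {c : Fin n} (A : Subset n) (F : Sunflower G c ℓ) → Fin ℓ →
  (∀ j → 2 ≤ ∣ petal F j ∩ A ∣) →
  Σ (Fin (suc ℓ) → Fin n) λ g → Injective _≡_ _≡_ g × (∀ t → ∃ λ j → g t ∈ petal F j) × (∀ t → g t ∈ A)
transversal {n = n} {ℓ} {c = c} A F j₀ two = g , g-inj , proj₁ ∘ g∈ , proj₂ ∘ g∈
  where
  second : ∀ j y → ∃ λ x → x ∈ petal F j × x ∈ A × x ≢ y
  second j y with outside-list (petal F j ∩ A) (y ∷ []) (two j)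
  ... | x , x∈ , x∉ = x , proj₁ (x∈p∩q⁻ (petal F j) A x∈) , proj₂ (x∈p∩q⁻ (petal F j) A x∈) , λ { refl → x∉ (here refl) }
  x : Fin ℓ → Fin n
  x j = proj₁ (second j c)
  x∈ : ∀ j → x j ∈ petal F j
  x∈ j = proj₁ (proj₂ (second j c))
  x≢c : ∀ j → x j ≢ c
  x≢c j = proj₂ (proj₂ (proj₂ (second j c)))
  x-inj : ∀ {i j} → x i ≡ x j → i ≡ j
  x-inj {i} {j} eq = meet F (x∈ i) (subst (_∈ petal F j) (sym eq) (x∈ j)) (x≢c i)
  extra : ∃ λ y → (∃ λ j → y ∈ petal F j) × y ∈ A × (∀ j → y ≢ x j)
  extra with c ∈? A
  ... | yes c∈A = c , (j₀ , core F j₀) , c∈A , λ j eq → x≢c j (sym eq)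
  ... | no c∉A with second j₀ (x j₀)
  ...   | y , y∈ , y∈A , y≢ = y , (j₀ , y∈) , y∈A , new
    where
    new : ∀ j → y ≢ x j
    new j refl with meet F {j₀} {j} y∈ (x∈ j) (λ { y≡c → c∉A (subst (_∈ A) y≡c y∈A) })
    ... | refl = y≢ refl
  g : Fin (suc ℓ) → Fin n
  g zero    = proj₁ extra
  g (suc j) = x j
  g-inj : Injective _≡_ _≡_ g
  g-inj {zero}  {zero}  eq = refl
  g-inj {zero}  {suc j} eq = contradiction eq (proj₂ (proj₂ (proj₂ extra)) j)
  g-inj {suc i} {zero}  eq = contradiction (sym eq) (proj₂ (proj₂ (proj₂ extra)) i)
  g-inj {suc i} {suc j} eq = cong suc (x-inj eq)
  g∈ : ∀ t → (∃ λ j → g t ∈ petal F j) × g t ∈ A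
  g∈ zero    = proj₁ (proj₂ extra) , proj₁ (proj₂ (proj₂ extra))
  g∈ (suc j) = (j , x∈ j) , proj₁ (proj₂ (proj₂ (second j c)))

twoIn : ∀ {a b n} r → Shuffle a b n → RGraph r n
twoIn r sh = record
  { edge    = λ U → (∣ U ∣ ≡ᵇ r) ∧ (2 ≤ᵇ ∣ left sh U ∣)
  ; uniform = λ U t → ≡ᵇ⇒≡ ∣ U ∣ r (proj₁ (T-∧⁻ t))
  }

-- By `transversal` the star with `ℓ i` petals occupies `ℓ i + 1` vertices of the left part, and
-- disjoint stars occupy different ones.
twoIn-forest-free : ∀ {a b n} r k (ℓ : Fin k → ℕ) (sh : Shuffle a b n) → (∀ i → 1 ≤ ℓ i) →
  a < sumFin k (λ i → ℓ i + 1) → ¬ Contains (starForest r k ℓ) (twoIn r sh)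
twoIn-forest-free {a} r k ℓ sh ℓ≥1 a< con =
  <⇒≱ a< (subst₂ _≤_ (cong sum (map-cong (λ i → sym (+-comm (ℓ i) 1)) (allFin k))) (∣leftPart∣ sh)
    (disjoint-images k (suc ∘ ℓ) (proj₁ ∘ tr) (proj₁ ∘ proj₂ ∘ tr)
      (λ {i} {i′} {j} {j′} → separate i i′ j j′) (leftPart sh) (λ i → proj₂ (proj₂ (proj₂ (tr i))))))
  where
  𝓕 : Forest (twoIn r sh) k ℓ
  𝓕 = contains⇒forest {G = twoIn r sh} con
  tr = λ i → transversal (leftPart sh) (starAt 𝓕 i) (F.fromℕ< (ℓ≥1 i)) λ j →
    subst (2 ≤_) (∣left∣ sh _) (≤ᵇ⇒≤ 2 _ (proj₂ (T-∧⁻ {∣ petal (starAt 𝓕 i) j ∣ ≡ᵇ r} (petal-edge (starAt 𝓕 i) j))))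
  separate : ∀ i i′ j j′ → proj₁ (tr i) j ≡ proj₁ (tr i′) j′ → i ≡ i′
  separate i i′ j j′ eq = disjoint 𝓕 (proj₂ (proj₁ (proj₂ (proj₂ (tr i))) j))
    (subst (_∈ petal (starAt 𝓕 i′) (proj₁ (proj₁ (proj₂ (proj₂ (tr i′))) j′))) (sym eq) (proj₂ (proj₁ (proj₂ (proj₂ (tr i′))) j′)))

-- Fix `s - q` vertices on the left and vary `q = r - 2` vertices on the right. An `r`-subset of the
-- union has at most `q` vertices on the right, hence two on the left.
twoIn-cliques : ∀ {a b n} q (sh : Shuffle a b n) s → q ≤ s → s ∸ q ≤ a → b C q ≤ NK s (twoIn (2 + q) sh)
twoIn-cliques {a} {b} {n} q sh s q≤s s∸q≤a with subset-of-size {n = a} (s ∸ q) s∸q≤a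
... | A , ∣A∣ = begin
  b C q                                                                    ≡⟨ sym (sumOver-size b q) ⟩
  sumOver b (λ X → ⟦ ∣ X ∣ ≡ᵇ q ⟧)                                         ≤⟨ sumOver-mono b (λ X → ⟦⟧-mono (copy X)) ⟩
  sumOver b (λ X → ⟦ isCopyOfK G s (merge sh A X) ⟧)                       ≤⟨ term≤sumOver a (λ A → sumOver b (λ X → ⟦ isCopyOfK G s (merge sh A X) ⟧)) A ⟩
  sumOver a (λ A → sumOver b (λ X → ⟦ isCopyOfK G s (merge sh A X) ⟧))     ≡⟨ sym (sumOver-merge sh (λ S → ⟦ isCopyOfK G s S ⟧)) ⟩
  sumOver n (λ S → ⟦ isCopyOfK G s S ⟧)                                    ≡⟨ sym (length-filterᵇ-allSubsets n (isCopyOfK G s)) ⟩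
  NK s G                                                                   ∎
  where
  open ≤-Reasoning
  G = twoIn (2 + q) sh
  copy : ∀ X → T (∣ X ∣ ≡ᵇ q) → T (isCopyOfK G s (merge sh A X))
  copy X t = T-∧⁺ (≡⇒≡ᵇ ∣ merge sh A X ∣ s (trans (∣merge∣ sh A X) (trans (cong₂ _+_ ∣A∣ (≡ᵇ⇒≡ ∣ X ∣ q t)) (m∸n+n≡m q≤s))))
    (isClique?⁺ G (merge sh A X) λ {U} c sub → T-∧⁺ (≡⇒≡ᵇ ∣ U ∣ (2 + q) c) (≤⇒≤ᵇ (two U c sub)))
    where
    two : ∀ U → ∣ U ∣ ≡ 2 + q → U ⊆ merge sh A X → 2 ≤ ∣ left sh U ∣
    two U c sub = +-cancelʳ-≤ q 2 ∣ left sh U ∣ (begin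
      2 + q                              ≡⟨ sym (trans (∣left∣+∣right∣ sh U) c) ⟩
      ∣ left sh U ∣ + ∣ right sh U ∣     ≤⟨ +-monoʳ-≤ ∣ left sh U ∣ (p⊆q⇒∣p∣≤∣q∣ (λ x∈ → subst (_ ∈_) (right-merge sh A X) (right-mono sh sub x∈))) ⟩
      ∣ left sh U ∣ + ∣ X ∣              ≡⟨ cong (∣ left sh U ∣ +_) (≡ᵇ⇒≡ ∣ X ∣ q t) ⟩
      ∣ left sh U ∣ + q                  ∎)

-- Assembling both parts of the theorem

module Conclusion (p a : ℕ) (ℓ : Fin (suc a) → ℕ) (decreasing : ∀ i j → i F.≤ j → ℓ j ≤ ℓ i) (ℓ≥1 : ∀ i → 1 ≤ ℓ i)
  (s : ℕ) (r≤s : 3 + p ≤ s) where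

  private
    r₀ q₀ t : ℕ
    r₀ = 3 + p
    q₀ = suc p
    -- One vertex fewer than the stars together would occupy inside the left part of `twoIn`.
    t = sumFin (suc a) (λ i → ℓ i + 1) ∸ 1

    Upper : Set
    Upper = Σ ℕ λ K → Σ ℕ λ N₀ → ∀ n → N₀ ≤ n → ∀ m → IsEx r₀ n s (starForest r₀ (suc a) ℓ) m → m ≤ K * n ^ q₀

    ExactAt : ℕ → ℕ → Set
    ExactAt n b = Σ ℕ λ M →
      IsMax {RGraph r₀ b} (λ G → ¬ StarEmbedding G (ℓ (fromℕ a))) (λ G → sumFromTo r₀ s (λ i → (a C (s ∸ i)) * NK i G)) M
      × IsEx r₀ n s (starForest r₀ (suc a) ℓ) (sumFromTo 0 (2 + p) (λ i → (a C (s ∸ i)) * (b C i)) + M)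

    Exact : Set
    Exact = Σ ℕ λ N₀ → ∀ n → N₀ ≤ n → ExactAt n (n ∸ suc a + 1)

  module _ (L : ℕ) (L-large : a + (a * suc (ℓ zero * (3 + p)) + (ℓ zero * (3 + p) + ℓ zero)) ≤ L)
           (K : ℕ) (K-bounds : CliqueBound p (L * (3 + p)) K) where
    open UpperBound p a ℓ decreasing ℓ≥1 L L-large K K-bounds

    private
      upper′ : a + r₀ ≤ s → Upper
      upper′ a+r≤s = sumOfBinomials a r₀ s * K , a , λ { n a≤n m ((G , free , refl) , _) → upper-ii s r≤s a+r≤s n a≤n G free }

      exact′ : s ≤ a + (2 + p) → (Σ ℕ λ N₁ → ∀ b → N₁ ≤ b → Dominates s b) → Exact
      exact′ s≤ (N₁ , dom) = N₁ + suc a , result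
        where
        -- The `a = k - 1` vertices of the cone and the other `n - k + 1` make up all `n`; the
        -- truncated subtraction is exact because `n ≥ k`.
        n≡ : ∀ n → N₁ + suc a ≤ n → a + (n ∸ suc a + 1) ≡ n
        n≡ n N₀≤n = trans (cong (a +_) (+-comm (n ∸ suc a) 1))
          (trans (+-suc a (n ∸ suc a)) (m+[n∸m]≡n (≤-trans (m≤n+m (suc a) N₁) N₀≤n)))
        result : ∀ n → N₁ + suc a ≤ n → ExactAt n (n ∸ suc a + 1)
        result n N₀≤n = subst (λ n′ → ExactAt n′ (n ∸ suc a + 1)) (n≡ n N₀≤n)
          (part-i s r≤s s≤ (n ∸ suc a + 1) (dom (n ∸ suc a + 1) (≤-trans (m+n≤o⇒m≤o∸n N₁ N₀≤n) (m≤m+n (n ∸ suc a) 1))))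

    exact-and-upper : (s ≤ a + (2 + p) → Exact) × (a + r₀ ≤ s → Upper)
    exact-and-upper = (λ s≤ → exact′ s≤ (C-dominates (sumOfBinomials (a ∸ 1) r₀ s * K) q₀)) , upper′

  conclusion : (s ≤ a + (2 + p) → Exact) × (a + r₀ ≤ s → Upper)
  -- `L` is taken equal to the greedy budget, and `K` is the clique constant for covers of size
  -- `L * r`.
  conclusion = exact-and-upper _ ≤-refl (proj₁ bound) (proj₂ bound)
    where bound = cliqueBound p ((a + (a * suc (ℓ zero * (3 + p)) + (ℓ zero * (3 + p) + ℓ zero))) * (3 + p))

  -- The maximum is at least the clique count of `twoIn` with `t` vertices on the left, hence at
  -- least `(n - t) C (r - 2)`, which has order `n ^ (r - 2)`.
  lower : s ≤ sumFin (suc a) (λ i → ℓ i + 1) + r₀ ∸ 3 → Σ ℕ λ c → Σ ℕ λ d → 1 ≤ c × (Σ ℕ λ N₀ → ∀ n → N₀ ≤ n → ∀ m →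
    IsEx r₀ n s (starForest r₀ (suc a) ℓ) m → c * n ^ q₀ ≤ d * m)
  lower s≤ = 1 , suc (q₀ + t) ^ q₀ * q₀ ! , ≤-refl , suc q₀ + t , result
    where
    pos : 1 ≤ sumFin (suc a) (λ i → ℓ i + 1)
    pos = ≤-trans (≤-trans (ℓ≥1 zero) (m≤m+n _ 1)) (m≤m+n (ℓ zero + 1) _)
    t< : t < sumFin (suc a) (λ i → ℓ i + 1)
    t< = ≤-reflexive (m+[n∸m]≡n pos)
    -- The upper limit on `s` says exactly that the left part has room for the `s - (r - 2)` fixed
    -- vertices of `twoIn-cliques`.
    s∸q≤t : s ∸ q₀ ≤ t
    s∸q≤t = begin
      s ∸ q₀                              ≤⟨ ∸-monoˡ-≤ q₀ s≤ ⟩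
      (suc-t + r₀ ∸ 3) ∸ q₀                ≡⟨ cong (λ x → (x + r₀ ∸ 3) ∸ q₀) (sym (m+[n∸m]≡n pos)) ⟩
      (suc t + r₀ ∸ 3) ∸ q₀                ≡⟨ cong (λ x → (x ∸ 3) ∸ q₀) (shuffle t p) ⟩
      (t + q₀) ∸ q₀                        ≡⟨ m+n∸n≡m t q₀ ⟩
      t                                  ∎
      where
      open ≤-Reasoning
      suc-t = sumFin (suc a) (λ i → ℓ i + 1)
      shuffle : ∀ t p → suc t + (3 + p) ≡ 3 + (t + suc p)
      shuffle = solve-∀
    result : ∀ n → suc q₀ + t ≤ n → ∀ m → IsEx r₀ n s (starForest r₀ (suc a) ℓ) m → 1 * n ^ q₀ ≤ suc (q₀ + t) ^ q₀ * q₀ ! * m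
    result n N₀≤n m (_ , best) = begin
      1 * n ^ q₀                                   ≡⟨ *-identityˡ _ ⟩
      n ^ q₀                                       ≤⟨ C-lower q₀ t n N₀≤n ⟩
      suc (q₀ + t) ^ q₀ * q₀ ! * ((n ∸ t) C q₀)       ≤⟨ *-monoʳ-≤ (suc (q₀ + t) ^ q₀ * q₀ !) count ⟩
      suc (q₀ + t) ^ q₀ * q₀ ! * m                   ∎
      where
      open ≤-Reasoning
      t≤n : t ≤ n
      t≤n = ≤-trans (m≤n+m t (suc q₀)) N₀≤n
      count : (n ∸ t) C q₀ ≤ m
      count with subset-of-size {n = n} t t≤n
      ... | U , ∣U∣ with shuffleAt {a = t} {n ∸ t} U ∣U∣ (m+[n∸m]≡n t≤n)
      ...   | sh , _ = ≤-trans (twoIn-cliques q₀ sh s (≤-trans (m≤n+m q₀ 2) r≤s) s∸q≤t)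
                               (best (twoIn r₀ sh) (twoIn-forest-free r₀ (suc a) ℓ sh ℓ≥1 t<))

theorem2p6 : (r k : ℕ) (ℓ : Fin k → ℕ) (s : ℕ) →
    3 ≤ r → 1 ≤ k → (∀ (i j : Fin k) → i F.≤ j → ℓ j ≤ ℓ i) → (∀ i → 2 ≤ ℓ i) → r ≤ s →
    (s ≤ k + r ∸ 2 →
    Σ ℕ λ N₀ → ∀ n → N₀ ≤ n →
    Σ ℕ λ M →
    IsMax {RGraph r (n ∸ k + 1)} (λ G → ¬ Contains (expansion r (star (lastOf ℓ))) G)
    (λ G → sumFromTo r s (λ i → ((k ∸ 1) C (s ∸ i)) * NK i G)) M
    × IsEx r n s (starForest r k ℓ)
    (sumFromTo 0 (r ∸ 1) (λ i → ((k ∸ 1) C (s ∸ i)) * ((n ∸ k + 1) C i)) + M))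
    ×
    (k + r ∸ 1 ≤ s →
    (Σ ℕ λ C → Σ ℕ λ N₀ → ∀ n → N₀ ≤ n → ∀ m → IsEx r n s (starForest r k ℓ) m →
    m ≤ C * n ^ (r ∸ 2))
    × (s ≤ sumFin k (λ i → ℓ i + 1) + r ∸ 3 →
    (Σ ℕ λ C → Σ ℕ λ N₀ → ∀ n → N₀ ≤ n → ∀ m → IsEx r n s (starForest r k ℓ) m →
    m ≤ C * n ^ (r ∸ 2))
    × (Σ ℕ λ c → Σ ℕ λ d → 1 ≤ c × (Σ ℕ λ N₀ → ∀ n → N₀ ≤ n → ∀ m →
    IsEx r n s (starForest r k ℓ) m → c * n ^ (r ∸ 2) ≤ d * m))))
theorem2p6 (suc (suc (suc p))) (suc a) ℓ s (s≤s (s≤s (s≤s z≤n))) _ decreasing ℓ≥2 r≤s =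
  (λ s≤ → proj₁ conclusion (≤-trans s≤ (≤-reflexive (cong (_∸ 1) (+-suc a (2 + p)))))) ,
  λ a+r≤s → proj₂ conclusion a+r≤s , λ s≤ → proj₂ conclusion a+r≤s , lower s≤
  where
  open Conclusion p a ℓ decreasing (λ i → ≤-trans (s≤s z≤n) (ℓ≥2 i)) s r≤s
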